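{- There exists a small constant $\varepsilon_0>0$ for which the following hardness result holds. For any sublinear-time algorithm $\mathcal{A}$ that, given a $1$-diagonally dominant matrix $S\in\mathbb{R}^{n\times n}$ satisfying $S_{\max}=\Theta(\sqrt n)$ and $\Delta^S_{\max}=O(1)$, and any Boolean vector $b\in\{0,1\}^n$, solves the linear system $Sz=b$ with additive error $\varepsilon_0$, the algorithm $\mathcal{A}$ must make $\Omega(S_{\max})$ queries to the $(S,b)$-oracle.
   Context: $[n]=\{1,\dots,n\}$. A matrix $S\in\mathbb{R}^{n\times n}$ is $1$-diagonally dominant if $|S_{ii}|\ge 1+\sum_{j\ne i}|S_{ij}|$ for all $i\in[n]$; such $S$ is non-singular. $S_{\max}=\max_{i\in[n]}|S_{ii}|$ and $\Delta^S_{\max}=\max_{u\in[n]}|\{v\in[n]: v\ne u,\ S_{uv}\ne0\}|$. The matrix $S$ is viewed as a weighted directed graph on $[n]$ with an edge $(u,v)$ of weight $S_{uv}$ whenever $u\ne v$ and $S_{uv}\neq 0$. $\Delta^{\mathrm{out}}_u$ is the number of out-edges of $u$, and $d^{\mathrm{out}}_u=\sum_{v\ne u}|S_{uv}|$. The $(S,b)$-oracle answers the following queries, each at unit query cost: 1. Vertex query: given $u\in[n]$, return $\Delta^{\mathrm{out}}_u$, $d^{\mathrm{out}}_u$, $S_{uu}$ and $b_u$. 2. Neighbor query: given $u\in[n]$ and $i\in[\Delta^{\mathrm{out}}_u]$, return the $i$-th out-neighbor of $u$ under a fixed but arbitrary ordering. 3. Random walk query: given $u\in[n]$, return a random out-neighbor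 $v\ne u$ chosen with probability proportional to $|S_{uv}|$, along with $S_{uv}$; if $u$ has no out-neighbors return a special symbol $\perp$. The algorithm accesses $S$ and $b$ only through the oracle. A sublinear-time algorithm with access to the $(S,b)$-oracle (for non-singular $S$) solves $Sz=b$ with additive error $\varepsilon$ if for any $u\in[n]$ it returns a random value $z_u$ satisfying $|z_u-z^*_u|\le\varepsilon$ with probability at least $2/3$, where $z^*$ is the unique solution of $Sz^*=b$. -}

module Defs where

open import Algebra.Bundles using (CommutativeRing)
open import Algebra.Structures using (IsCommutativeRing)
import Algebra.Definitions.RawMonoid as RawMonoidDefinitions
open import Data.Bool.Base using (if_then_else_)
open import Data.Fin.Base using (Fin)
open import Data.Fin.Properties using () renaming (_≟_ to _≟ᶠ_)
open import Data.List.Base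
  using (List; []; _∷_; [_]; _++_; allFin; concatMap; drop; filter; foldr; head; length; map)
import Data.List.Extrema as Extrema
import Data.List.Extrema.Nat as ℕ-Extrema
open import Data.List.Relation.Binary.Permutation.Propositional using (_↭_)
open import Data.Maybe.Base using (Maybe; just; nothing)
open import Data.Nat.Base as ℕ using (ℕ; zero; suc)
open import Data.Product.Base using (_×_; _,_; ∃; proj₁; proj₂)
open import Data.Sum.Base using (_⊎_; inj₁; inj₂)
open import Level using (0ℓ)
open import Relation.Binary.Bundles using (DecTotalOrder)
open import Relation.Binary.PropositionalEquality
  using (_≡_; _≢_; sym; trans; cong; subst; subst₂)
open import Relation.Binary.Structures using (IsDecTotalOrder)
open import Relation.Nullary.Decidable using (does; ¬?; _×-dec_)
open import Relation.Unary using (Pred; Decidable)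

-- The real numbers, given axiomatically as a complete ordered field (unique up
-- to isomorphism).  The theory is the classical one: the order is decidable and
-- every inhabited predicate that is bounded above has a supremum.  The value
-- of 0# ⁻¹ is left unspecified.
record Reals : Set₁ where
  infix  8 -_ _⁻¹
  infixl 7 _*_
  infixl 6 _+_
  infix  4 _≤_ _<_
  field
    Carrier           : Set
    _≤_               : Carrier → Carrier → Set
    _+_ _*_           : Carrier → Carrier → Carrier
    -_ _⁻¹            : Carrier → Carrier
    0# 1#             : Carrier
    isCommutativeRing : IsCommutativeRing _≡_ _+_ _*_ -_ 0# 1#
    0≢1               : 0# ≢ 1#
    ⁻¹-inverseʳ       : ∀ x → x ≢ 0# → x * x ⁻¹ ≡ 1#
    isDecTotalOrder   : IsDecTotalOrder _≡_ _≤_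
    +-monoˡ-≤         : ∀ z {x y} → x ≤ y → x + z ≤ y + z
    *-nonNeg          : ∀ {x y} → 0# ≤ x → 0# ≤ y → 0# ≤ x * y
    supremum          : (P : Pred Carrier 0ℓ) → ∃ P →
                        (∃ λ b → ∀ x → P x → x ≤ b) →
                        ∃ λ s → (∀ x → P x → x ≤ s) ×
                                (∀ b → (∀ x → P x → x ≤ b) → s ≤ b)

  commutativeRing : CommutativeRing 0ℓ 0ℓ
  commutativeRing = record { isCommutativeRing = isCommutativeRing }

  decTotalOrder : DecTotalOrder 0ℓ 0ℓ 0ℓ
  decTotalOrder = record { isDecTotalOrder = isDecTotalOrder }

  open CommutativeRing commutativeRing public
    using ( _-_; +-rawMonoid; ring; +-assoc; +-comm; +-identityˡ; +-identityʳ
          ; -‿inverseˡ; -‿inverseʳ; *-assoc; *-comm; *-identityˡ; *-identityʳ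
          ; distribˡ; distribʳ; zeroˡ; zeroʳ )
  open DecTotalOrder decTotalOrder public
    using (_≟_; _≤?_; total; totalOrder; antisym)
    renaming (refl to ≤-refl; trans to ≤-trans; reflexive to ≤-reflexive)
  open RawMonoidDefinitions +-rawMonoid public using (sum)

  _<_ : Carrier → Carrier → Set
  x < y = x ≤ y × x ≢ y

  ∣_∣ : Carrier → Carrier
  ∣ x ∣ = if does (0# ≤? x) then x else - x

  fromℕ : ℕ → Carrier
  fromℕ zero    = 0#
  fromℕ (suc n) = 1# + fromℕ n

  private
    open import Algebra.Properties.Ring ring using (-‿distribˡ-*; -‿distribʳ-*; -‿involutive)

    +-nonNeg : ∀ {x y} → 0# ≤ x → 0# ≤ y → 0# ≤ x + y
    +-nonNeg {x} {y} 0≤x 0≤y =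
      ≤-trans 0≤y (subst (_≤ x + y) (+-identityˡ y) (+-monoˡ-≤ y 0≤x))

    0≤y-x : ∀ {x y} → x ≤ y → 0# ≤ y + - x
    0≤y-x {x} {y} x≤y = subst (_≤ y + - x) (-‿inverseʳ x) (+-monoˡ-≤ (- x) x≤y)

    0≤1 : 0# ≤ 1#
    0≤1 with total 0# 1#
    ... | inj₁ 0≤1 = 0≤1
    ... | inj₂ 1≤0 = subst (0# ≤_) -1*-1≡1 (*-nonNeg 0≤-1 0≤-1)
      where
      0≤-1 : 0# ≤ - 1#
      0≤-1 = subst (0# ≤_) (+-identityˡ (- 1#)) (0≤y-x 1≤0)
      -1*-1≡1 : - 1# * - 1# ≡ 1#
      -1*-1≡1 = trans (sym (-‿distribˡ-* 1# (- 1#)))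
                      (trans (cong -_ (*-identityˡ (- 1#))) (-‿involutive 1#))

    0≤fromℕ : ∀ n → 0# ≤ fromℕ n
    0≤fromℕ zero    = ≤-refl
    0≤fromℕ (suc n) = +-nonNeg 0≤1 (0≤fromℕ n)

    x≤x² : ∀ {x} → 1# ≤ x → x ≤ x * x
    x≤x² {x} 1≤x = subst₂ _≤_ (+-identityˡ x) lemma (+-monoˡ-≤ x 0≤x[x-1])
      where
      0≤x[x-1] : 0# ≤ x * (x + - 1#)
      0≤x[x-1] = *-nonNeg (≤-trans 0≤1 1≤x) (0≤y-x 1≤x)
      lemma : x * (x + - 1#) + x ≡ x * x
      lemma = trans (cong (x * (x + - 1#) +_) (sym (*-identityʳ x)))
             (trans (sym (distribˡ x (x + - 1#) 1#))
             (cong (x *_) (trans (+-assoc x (- 1#) 1#)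
                          (trans (cong (x +_) (-‿inverseˡ 1#)) (+-identityʳ x)))))

    x²≤n⇒x≤1+n : ∀ n x → x * x ≤ fromℕ n → x ≤ fromℕ (suc n)
    x²≤n⇒x≤1+n n x x²≤n with total x 1#
    ... | inj₁ x≤1 = ≤-trans x≤1
          (subst₂ _≤_ (+-identityˡ 1#) (+-comm (fromℕ n) 1#) (+-monoˡ-≤ 1# (0≤fromℕ n)))
    ... | inj₂ 1≤x = ≤-trans (x≤x² 1≤x) (≤-trans x²≤n
          (subst (_≤ fromℕ (suc n)) (+-identityˡ (fromℕ n)) (+-monoˡ-≤ (fromℕ n) 0≤1)))

  -- The square root of n is sup { x | x² ≤ n }.
  √-supremum : (n : ℕ) →
               ∃ λ s → (∀ x → x * x ≤ fromℕ n → x ≤ s) ×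
                       (∀ b → (∀ x → x * x ≤ fromℕ n → x ≤ b) → s ≤ b)
  √-supremum n = supremum (λ x → x * x ≤ fromℕ n)
    (0# , subst (_≤ fromℕ n) (sym (zeroˡ 0#)) (0≤fromℕ n))
    (fromℕ (suc n) , x²≤n⇒x≤1+n n)

  √ : ℕ → Carrier
  √ n = proj₁ (√-supremum n)

data Query (n : ℕ) : Set where
  vertex     : Fin n → Query n
  neighbor   : Fin n → ℕ → Query n
  randomWalk : Fin n → Query n

module LinearSystems (ℛ : Reals) where
  open Reals ℛ

  Vector : ℕ → Set
  Vector n = Fin n → Carrier

  Matrix : ℕ → Set
  Matrix n = Fin n → Fin n → Carrier

  module _ {n : ℕ} where

    infixr 7 _·_
    _·_ : Matrix n → Vector n → Vector n
    (S · z) i = sum λ j → S i j * z j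

    Boolean : Vector n → Set
    Boolean b = ∀ u → b u ≡ 0# ⊎ b u ≡ 1#

    dᵒᵘᵗ : Matrix n → Fin n → Carrier
    dᵒᵘᵗ S u = sum λ v → if does (u ≟ᶠ v) then 0# else ∣ S u v ∣

    DiagonallyDominant₁ : Matrix n → Set
    DiagonallyDominant₁ S = ∀ i → 1# + dᵒᵘᵗ S i ≤ ∣ S i i ∣

    outNeighbors : Matrix n → Fin n → List (Fin n)
    outNeighbors S u = filter (λ v → ¬? (u ≟ᶠ v) ×-dec ¬? (S u v ≟ 0#)) (allFin n)

    Δᵒᵘᵗ : Matrix n → Fin n → ℕ
    Δᵒᵘᵗ S u = length (outNeighbors S u)

    -- The default value 0 of both maxima is irrelevant: the entries are
    -- non-negative.
    Smax : Matrix n → Carrier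
    Smax S = Extrema.max totalOrder 0# (map (λ i → ∣ S i i ∣) (allFin n))

    Δmax : Matrix n → ℕ
    Δmax S = ℕ-Extrema.max 0 (map (Δᵒᵘᵗ S) (allFin n))

    -- The constants c₁, c₂ and D make S_max = Θ(√n) and Δ_max = O(1) explicit.
    record Promise (c₁ c₂ : Carrier) (D : ℕ) (S : Matrix n) (b : Vector n) : Set where
      field
        dominant  : DiagonallyDominant₁ S
        Smax-Ω√n  : c₁ * √ n ≤ Smax S
        Smax-O√n  : Smax S ≤ c₂ * √ n
        Δmax-O1   : Δmax S ℕ.≤ D
        boolean   : Boolean b

    record NeighborOrdering (S : Matrix n) : Set where
      field
        neighbors : Fin n → List (Fin n)
        ordering  : ∀ u → neighbors u ↭ outNeighbors S u

  -- Finitely supported distributions, as lists of weighted outcomes.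
  Dist : Set → Set
  Dist A = List (Carrier × A)

  private variable A B : Set

  scale : Carrier → Dist A → Dist A
  scale p = map λ (q , x) → p * q , x

  pure : A → Dist A
  pure x = [ 1# , x ]

  bind : Dist A → (A → Dist B) → Dist B
  bind d f = concatMap (λ (p , x) → scale p (f x)) d

  Pr : {P : Pred A 0ℓ} → Dist A → Decidable P → Carrier
  Pr d P? = foldr _+_ 0# (map proj₁ (filter (λ (_ , x) → P? x) d))

  -- A vertex query returns (Δᵒᵘᵗ u , dᵒᵘᵗ u , S u u , b u).  In the other two
  -- cases "nothing" stands for an index out of range and for ⊥, respectively.
  Response : ∀ {n} → Query n → Set
  Response     (vertex u)     = ℕ × Carrier × Carrier × Carrier
  Response {n} (neighbor u i) = Maybe (Fin n)
  Response {n} (randomWalk u) = Maybe (Fin n × Carrier)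

  -- Randomized adaptive algorithms, as decision trees: between queries an
  -- algorithm computes arbitrarily and tosses coins of arbitrary bias.  Only
  -- queries are charged.
  data Algorithm (n : ℕ) : Set where
    return : Carrier → Algorithm n
    toss   : (p : Carrier) → 0# ≤ p → p ≤ 1# → Algorithm n → Algorithm n → Algorithm n
    query  : (q : Query n) → (Response q → Algorithm n) → Algorithm n

  module Oracle {n} (S : Matrix n) (b : Vector n) (π : NeighborOrdering S) where
    open NeighborOrdering π

    walk : Fin n → List (Fin n) → Dist (Maybe (Fin n × Carrier))
    walk u []         = pure nothing
    walk u vs@(_ ∷ _) = map (λ v → ∣ S u v ∣ * dᵒᵘᵗ S u ⁻¹ , just (v , S u v)) vs

    -- Neighbor indices count from 0.
    answer : (q : Query n) → Dist (Response q)
    answer (vertex u)     = pure (Δᵒᵘᵗ S u , dᵒᵘᵗ S u , S u u , b u)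
    answer (neighbor u i) = pure (head (drop i (neighbors u)))
    answer (randomWalk u) = walk u (outNeighbors S u)

    -- The joint distribution of the output and the number of queries made.
    run : Algorithm n → Dist (Carrier × ℕ)
    run (return z)        = pure (z , 0)
    run (toss p _ _ 𝒜 ℬ) = scale p (run 𝒜) ++ scale (1# - p) (run ℬ)
    run (query q k)       =
      bind (answer q) λ r → map (λ (p , z , t) → p , z , suc t) (run (k r))

  open Oracle public using (run)

  -- "𝒜 solves Sz = b with additive error ε" for all S and b satisfying the
  -- promise and every neighbor ordering; 𝒜 u is the algorithm on input u.
  Solves : ∀ {n} → (Fin n → Algorithm n) → (ε c₁ c₂ : Carrier) → ℕ → Set
  Solves 𝒜 ε c₁ c₂ D =
    ∀ S b → Promise c₁ c₂ D S b → (π : NeighborOrdering S) →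
    ∀ z* → (∀ i → (S · z*) i ≡ b i) → ∀ u →
    fromℕ 2 * fromℕ 3 ⁻¹ ≤ Pr (run S b π (𝒜 u)) (λ (z , _) → ∣ z - z* u ∣ ≤? ε)

{-# OPTIONS --safe #-}

-- The hard systems hide a directed path x 0 , … , x L among n vertices, where
-- L = ⌊√n/4⌋ and all other vertices are isolated.  Path edges have weight -w with
-- w = 2L - 1 and their sources have diagonal entry 1 + w, so that z_{x 0} equals
-- (w / (1 + w))^L b_{x L}, which is at least b_{x L} / 2: an algorithm run on
-- x 0 has to tell b_{x L} = 1 from b = 0, hence has to query x L.  With fewer than
-- L queries this requires, for some k, that x (k + 1) is queried before x k.  Up to
-- the first query at x k the run depends on x 0 , … , x k only, and its at most L
-- queries spread over n vertices, so x (k + 1) can be chosen greedily, among the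
-- vertices not yet on the path, to be hit with probability at most 2L/n.  The
-- sum of these probabilities over k is at most 2L²/n ≤ 1/8.
module Submission where

open import Defs
open import Algebra.Bundles using (CommutativeRing)
import Algebra.Properties.Ring as RingProperties
import Algebra.Properties.Semiring.Exp as SemiringExp
import Algebra.Properties.Semiring.Sum as SemiringSum
import Algebra.Solver.Ring.NaturalCoefficients.Default as SemiringSolver
open import Data.Bool.Base using (if_then_else_; true; false)
open import Data.Fin.Base using (Fin; zero; suc)
open import Data.Fin.Properties using (suc-injective) renaming (_≟_ to _≟ᶠ_)
open import Data.List.Base
  using ([]; _∷_; [_]; _++_; allFin; drop; filter; fromMaybe; head; length; map; tabulate)
import Data.List.Extrema as Extrema
import Data.List.Extrema.Nat as ℕ-Extrema
open import Data.List.Membership.Propositional using (_∈_)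
open import Data.List.Membership.Propositional.Properties using (∈-map⁺; ∈-allFin)
open import Data.List.Properties using (filter-none; filter-accept; filter-reject; ++-identityʳ)
open import Data.List.Relation.Binary.Permutation.Propositional using (↭-refl)
open import Data.List.Relation.Unary.All.Properties using (tabulate⁺; map⁺)
open import Data.Maybe.Base as Maybe using (Maybe; just; nothing)
open import Data.Maybe.Properties using (just-injective)
open import Data.Nat.Base as ℕ using (ℕ; zero; suc; z≤n; s≤s)
import Data.Nat.Properties as ℕₚ
open import Data.Nat.Tactic.RingSolver using (solve-∀)
open import Data.Product.Base using (_×_; _,_; ∃; proj₁; proj₂)
open import Data.Sum.Base using (_⊎_; inj₁; inj₂)
open import Function.Base using (_∘_; id)
open import Level using (0ℓ)
open import Relation.Binary.Bundles using (DecTotalOrder)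
open import Relation.Binary.PropositionalEquality
  using (_≡_; _≢_; refl; sym; trans; cong; cong₂; subst; subst₂)
import Relation.Binary.Reasoning.PartialOrder as PartialOrderReasoning
open import Relation.Nullary.Decidable using (Dec; yes; no; does; decidable-stable; from-no)
open import Relation.Nullary.Negation using (¬_; contradiction)
open import Relation.Unary using (Pred; Decidable)

-- Ordered field arithmetic and finite sums.

module OrderedField (ℛ : Reals) where
  open Reals ℛ
  open CommutativeRing commutativeRing using (semiring; commutativeSemiring)
  open RingProperties ring using (-‿distribˡ-*; -‿involutive; -0#≈0#; ⁻¹-anti-homo‿-)
  open SemiringSum semiring public using (sum-cong-≗; ∑-distrib-+; *-distribˡ-sum; sum-replicate-zero)
  open SemiringExp semiring public using (_^_)
  open SemiringSolver commutativeSemiring public using (solve; _:+_; _:*_; _:=_)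
  open PartialOrderReasoning (DecTotalOrder.poset decTotalOrder) public

  private variable x y z t : Carrier

  if-yes : ∀ {A P : Set} {a b : A} (P? : Dec P) → P → (if does P? then a else b) ≡ a
  if-yes (yes _) _ = refl
  if-yes (no ¬p) p = contradiction p ¬p

  if-no : ∀ {A P : Set} {a b : A} (P? : Dec P) → ¬ P → (if does P? then a else b) ≡ b
  if-no (yes p) ¬p = contradiction p ¬p
  if-no (no _)  _  = refl

  +-monoʳ-≤ : ∀ z → x ≤ y → z + x ≤ z + y
  +-monoʳ-≤ {x} {y} z x≤y = subst₂ _≤_ (+-comm x z) (+-comm y z) (+-monoˡ-≤ z x≤y)

  +-mono-≤ : x ≤ y → z ≤ t → x + z ≤ y + t
  +-mono-≤ {y = y} {z} x≤y z≤t = ≤-trans (+-monoˡ-≤ z x≤y) (+-monoʳ-≤ y z≤t)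

  +-nonNeg : 0# ≤ x → 0# ≤ y → 0# ≤ x + y
  +-nonNeg 0≤x 0≤y = subst (_≤ _) (+-identityˡ 0#) (+-mono-≤ 0≤x 0≤y)

  x≤x+y : 0# ≤ y → x ≤ x + y
  x≤x+y {x = x} 0≤y = subst (_≤ x + _) (+-identityʳ x) (+-monoʳ-≤ x 0≤y)

  x≤y+x : 0# ≤ y → x ≤ y + x
  x≤y+x {x = x} 0≤y = subst (_≤ _ + x) (+-identityˡ x) (+-monoˡ-≤ x 0≤y)

  +-cancelˡ-≤ : ∀ z → z + x ≤ z + y → x ≤ y
  +-cancelˡ-≤ {x} {y} z le = subst₂ _≤_ (cancel x) (cancel y) (+-monoʳ-≤ (- z) le)
    where
    cancel : ∀ a → - z + (z + a) ≡ a
    cancel a = trans (sym (+-assoc (- z) z a))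
                     (trans (cong (_+ a) (-‿inverseˡ z)) (+-identityˡ a))

  x≤y⇒0≤y-x : x ≤ y → 0# ≤ y - x
  x≤y⇒0≤y-x {x} {y} x≤y = subst (_≤ y - x) (-‿inverseʳ x) (+-monoˡ-≤ (- x) x≤y)

  x+[y-x]≡y : ∀ x y → x + (y - x) ≡ y
  x+[y-x]≡y x y = begin-equality
    x + (y - x)    ≡⟨ cong (x +_) (+-comm y (- x)) ⟩
    x + (- x + y)  ≡⟨ +-assoc x (- x) y ⟨
    (x - x) + y    ≡⟨ cong (_+ y) (-‿inverseʳ x) ⟩
    0# + y         ≡⟨ +-identityˡ y ⟩
    y              ∎

  *-monoʳ-≤ : 0# ≤ z → x ≤ y → z * x ≤ z * y
  *-monoʳ-≤ {z} {x} {y} 0≤z x≤y = begin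
    z * x                ≤⟨ x≤x+y (*-nonNeg 0≤z (x≤y⇒0≤y-x x≤y)) ⟩
    z * x + z * (y - x)  ≡⟨ distribˡ z x (y - x) ⟨
    z * (x + (y - x))    ≡⟨ cong (z *_) (x+[y-x]≡y x y) ⟩
    z * y                ∎

  *-monoˡ-≤ : 0# ≤ z → x ≤ y → x * z ≤ y * z
  *-monoˡ-≤ {z} {x} {y} 0≤z x≤y = subst₂ _≤_ (*-comm z x) (*-comm z y) (*-monoʳ-≤ 0≤z x≤y)

  x≤0⇒0≤-x : x ≤ 0# → 0# ≤ - x
  x≤0⇒0≤-x {x} x≤0 = subst (0# ≤_) (+-identityˡ (- x)) (x≤y⇒0≤y-x x≤0)

  0≤1 : 0# ≤ 1#
  0≤1 with total 0# 1#
  ... | inj₁ 0≤1 = 0≤1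
  ... | inj₂ 1≤0 = subst (0# ≤_) -1*-1≡1 (*-nonNeg (x≤0⇒0≤-x 1≤0) (x≤0⇒0≤-x 1≤0))
    where
    -1*-1≡1 : - 1# * - 1# ≡ 1#
    -1*-1≡1 = trans (sym (-‿distribˡ-* 1# (- 1#)))
                    (trans (cong -_ (*-identityˡ (- 1#))) (-‿involutive 1#))

  1≰0 : ¬ 1# ≤ 0#
  1≰0 1≤0 = 0≢1 (antisym 0≤1 1≤0)

  0≤fromℕ : ∀ n → 0# ≤ fromℕ n
  0≤fromℕ zero    = ≤-refl
  0≤fromℕ (suc n) = +-nonNeg 0≤1 (0≤fromℕ n)

  fromℕ-mono : ∀ {m n} → m ℕ.≤ n → fromℕ m ≤ fromℕ n
  fromℕ-mono {n = n} z≤n = 0≤fromℕ n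
  fromℕ-mono (s≤s m≤n)   = +-monoʳ-≤ 1# (fromℕ-mono m≤n)

  fromℕ-cancel-≤ : ∀ {m n} → fromℕ m ≤ fromℕ n → m ℕ.≤ n
  fromℕ-cancel-≤ {zero}          _  = z≤n
  fromℕ-cancel-≤ {suc m} {zero}  le = contradiction (≤-trans (x≤x+y (0≤fromℕ m)) le) 1≰0
  fromℕ-cancel-≤ {suc m} {suc n} le = s≤s (fromℕ-cancel-≤ (+-cancelˡ-≤ 1# le))

  fromℕ-+ : ∀ m n → fromℕ (m ℕ.+ n) ≡ fromℕ m + fromℕ n
  fromℕ-+ zero    n = sym (+-identityˡ (fromℕ n))
  fromℕ-+ (suc m) n = trans (cong (1# +_) (fromℕ-+ m n)) (sym (+-assoc 1# (fromℕ m) (fromℕ n)))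

  fromℕ-* : ∀ m n → fromℕ (m ℕ.* n) ≡ fromℕ m * fromℕ n
  fromℕ-* zero    n = sym (zeroˡ (fromℕ n))
  fromℕ-* (suc m) n = begin-equality
    fromℕ (n ℕ.+ m ℕ.* n)              ≡⟨ fromℕ-+ n (m ℕ.* n) ⟩
    fromℕ n + fromℕ (m ℕ.* n)          ≡⟨ cong₂ _+_ (sym (*-identityˡ (fromℕ n))) (fromℕ-* m n) ⟩
    1# * fromℕ n + fromℕ m * fromℕ n   ≡⟨ distribʳ (fromℕ n) 1# (fromℕ m) ⟨
    (1# + fromℕ m) * fromℕ n           ∎

  fromℕ-1 : fromℕ 1 ≡ 1#
  fromℕ-1 = +-identityʳ 1#

  fromℕ-suc≢0 : ∀ n → fromℕ (suc n) ≢ 0#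
  fromℕ-suc≢0 n eq = contradiction (subst (1# ≤_) eq (x≤x+y (0≤fromℕ n))) 1≰0

  fromℕ-suc-inverse : ∀ n → fromℕ (suc n) * fromℕ (suc n) ⁻¹ ≡ 1#
  fromℕ-suc-inverse n = ⁻¹-inverseʳ (fromℕ (suc n)) (fromℕ-suc≢0 n)

  ⁻¹-positive : 0# < x → 0# < x ⁻¹
  ⁻¹-positive {x} (0≤x , 0≢x) = nonNeg , λ 0≡x⁻¹ →
    0≢1 (trans (sym (zeroʳ x)) (trans (cong (x *_) 0≡x⁻¹) x*x⁻¹≡1))
    where
    x*x⁻¹≡1 : x * x ⁻¹ ≡ 1#
    x*x⁻¹≡1 = ⁻¹-inverseʳ x (0≢x ∘ sym)
    nonNeg : 0# ≤ x ⁻¹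
    nonNeg with total 0# (x ⁻¹)
    ... | inj₁ le = le
    ... | inj₂ ge = contradiction (subst₂ _≤_ x*x⁻¹≡1 (zeroʳ x) (*-monoʳ-≤ 0≤x ge)) 1≰0

  fromℕ-suc-positive : ∀ n → 0# < fromℕ (suc n)
  fromℕ-suc-positive n = 0≤fromℕ (suc n) , fromℕ-suc≢0 n ∘ sym

  0≤x⇒∣x∣≡x : 0# ≤ x → ∣ x ∣ ≡ x
  0≤x⇒∣x∣≡x {x} = if-yes (0# ≤? x)

  ∣-x∣≡x : 0# ≤ x → ∣ - x ∣ ≡ x
  ∣-x∣≡x {x} 0≤x with 0# ≤? - x
  ... | no  _    = -‿involutive x
  ... | yes 0≤-x = trans (cong -_ x≡0) (trans -0#≈0# (sym x≡0))
    where
    x≡0 : x ≡ 0#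
    x≡0 = antisym (subst₂ _≤_ (+-identityʳ x) (-‿inverseʳ x) (+-monoʳ-≤ x 0≤-x)) 0≤x

  x≤∣x∣ : ∀ x → x ≤ ∣ x ∣
  x≤∣x∣ x with 0# ≤? x | total 0# x
  ... | yes _  | _        = ≤-refl
  ... | no 0≰x | inj₁ 0≤x = contradiction 0≤x 0≰x
  ... | no _   | inj₂ x≤0 = ≤-trans x≤0 (x≤0⇒0≤-x x≤0)

  -x≤∣x∣ : ∀ x → - x ≤ ∣ x ∣
  -x≤∣x∣ x with 0# ≤? x
  ... | no _    = ≤-refl
  ... | yes 0≤x = begin
    - x       ≤⟨ x≤y+x 0≤x ⟩
    x - x     ≡⟨ -‿inverseʳ x ⟩
    0#        ≤⟨ 0≤x ⟩
    x         ∎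

  -- Triangle inequality through `x`, used to show that one output cannot be close to the solutions
  -- of both systems. The term `x - 0#` is left unsimplified because it is the error against the
  -- zero solution.
  y≤∣x-0∣+∣x-y∣ : ∀ x y → y ≤ ∣ x - 0# ∣ + ∣ x - y ∣
  y≤∣x-0∣+∣x-y∣ x y = begin
    y                          ≡⟨ x+[y-x]≡y x y ⟨
    x + (y - x)
      ≡⟨ cong₂ _+_ (sym (trans (cong (x +_) -0#≈0#) (+-identityʳ x))) swap ⟩
    (x - 0#) + - (x - y)       ≤⟨ +-mono-≤ (x≤∣x∣ (x - 0#)) (-x≤∣x∣ (x - y)) ⟩
    ∣ x - 0# ∣ + ∣ x - y ∣      ∎
    where
    swap : y - x ≡ - (x - y)
    swap = sym (⁻¹-anti-homo‿- x y)

  sum-mono : ∀ {n} {f g : Fin n → Carrier} → (∀ i → f i ≤ g i) → sum f ≤ sum g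
  sum-mono {zero}  _   = ≤-refl
  sum-mono {suc n} f≤g = +-mono-≤ (f≤g zero) (sum-mono (f≤g ∘ suc))

  sum-const : ∀ n a → sum {n} (λ _ → a) ≡ fromℕ n * a
  sum-const zero    a = sym (zeroˡ a)
  sum-const (suc n) a =
    trans (cong₂ _+_ (sym (*-identityˡ a)) (sum-const n a)) (sym (distribʳ a 1# (fromℕ n)))

  single : ∀ {n} → Fin n → Carrier → Fin n → Carrier
  single i a j = if does (i ≟ᶠ j) then a else 0#

  sum-single : ∀ {n} (i : Fin n) a → sum (single i a) ≡ a
  sum-single {suc n} zero    a =
    trans (cong (a +_) (sum-replicate-zero n)) (+-identityʳ a)
  sum-single {suc n} (suc i) a = trans (+-identityˡ _) (sum-single i a)

  single-nonNeg : ∀ {n a} (i j : Fin n) → 0# ≤ a → 0# ≤ single i a j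
  single-nonNeg i j 0≤a with i ≟ᶠ j
  ... | yes _ = 0≤a
  ... | no  _ = ≤-refl

  minimum : ∀ {n} (f : Fin (suc n) → Carrier) → ∃ λ i → ∀ j → f i ≤ f j
  minimum {zero}  f = zero , λ { zero → ≤-refl }
  minimum {suc n} f with minimum (f ∘ suc)
  ... | i , min with total (f zero) (f (suc i))
  ...   | inj₁ le = zero , λ { zero → ≤-refl ; (suc j) → ≤-trans le (min j) }
  ...   | inj₂ ge = suc i , λ { zero → ge ; (suc j) → min j }

  -- The least value is at most the average. Multiplying by the number of points avoids a division.
  pigeonhole : ∀ {n} (f : Fin (suc n) → Carrier) {a} → sum f ≤ a →
               ∃ λ i → fromℕ (suc n) * f i ≤ a
  pigeonhole {n} f Σf≤a with minimum f
  ... | i , min = i , ≤-trans (≤-reflexive (sym (sum-const (suc n) (f i)))) (≤-trans (sum-mono min) Σf≤a)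

filter-tabulate : ∀ {A : Set} {P : Pred A 0ℓ} (P? : Decidable P) {n} (f : Fin n → A) i →
                  P (f i) → (∀ j → P (f j) → i ≡ j) → filter P? (tabulate f) ≡ [ f i ]
filter-tabulate P? f zero    p unique = trans (filter-accept P? p)
  (cong (f zero ∷_) (filter-none P? (tabulate⁺ λ j q → contradiction (unique (suc j) q) λ ())))
filter-tabulate P? f (suc i) p unique =
  trans (filter-reject P? (λ q → contradiction (unique zero q) λ ()))
        (filter-tabulate P? (f ∘ suc) i p (λ j q → suc-injective (unique (suc j) q)))

-- Probabilities of events under coin tosses and queries.

module Probability (ℛ : Reals) where
  open Reals ℛ
  open LinearSystems ℛ
  open OrderedField ℛ

  private variable
    A : Set
    P : Pred A 0ℓ

  Pr-++ : ∀ (d e : Dist A) (P? : Decidable P) → Pr (d ++ e) P? ≡ Pr d P? + Pr e P?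
  Pr-++ []            e P? = sym (+-identityˡ (Pr e P?))
  Pr-++ ((p , x) ∷ d) e P? with does (P? x)
  ... | true  = trans (cong (p +_) (Pr-++ d e P?)) (sym (+-assoc p (Pr d P?) (Pr e P?)))
  ... | false = Pr-++ d e P?

  Pr-scale : ∀ a (d : Dist A) (P? : Decidable P) → Pr (scale a d) P? ≡ a * Pr d P?
  Pr-scale a []            P? = sym (zeroʳ a)
  Pr-scale a ((p , x) ∷ d) P? with does (P? x)
  ... | true  = trans (cong (a * p +_) (Pr-scale a d P?)) (sym (distribˡ a p (Pr d P?)))
  ... | false = Pr-scale a d P?

  -- Charges one query: an event about a whole run is pulled back along `tick` to an event about the
  -- run after its first query.
  tick : Carrier × ℕ → Carrier × ℕ
  tick (z , t) = z , suc t

  Pr-tick : ∀ (d : Dist (Carrier × ℕ)) {P : Pred (Carrier × ℕ) 0ℓ} (P? : Decidable P) →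
            Pr (map (λ (p , z , t) → p , z , suc t) d) P? ≡ Pr d (P? ∘ tick)
  Pr-tick []                P? = refl
  Pr-tick ((p , z , t) ∷ d) P? with does (P? (z , suc t))
  ... | true  = cong (p +_) (Pr-tick d P?)
  ... | false = Pr-tick d P?

  mix : Carrier → Carrier → Carrier → Carrier
  mix p x y = p * x + (1# - p) * y

  mix-mono : ∀ {p x x′ y y′} → 0# ≤ p → p ≤ 1# → x ≤ x′ → y ≤ y′ → mix p x y ≤ mix p x′ y′
  mix-mono 0≤p p≤1 x≤x′ y≤y′ =
    +-mono-≤ (*-monoʳ-≤ 0≤p x≤x′) (*-monoʳ-≤ (x≤y⇒0≤y-x p≤1) y≤y′)

  mix-const : ∀ p x → mix p x x ≡ x
  mix-const p x = trans (sym (distribʳ x p (1# - p)))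
                 (trans (cong (_* x) (x+[y-x]≡y p 1#)) (*-identityˡ x))

  mix-+ : ∀ p x x′ y y′ → mix p (x + x′) (y + y′) ≡ mix p x y + mix p x′ y′
  mix-+ p x x′ y y′ = solve 6
    (λ p q x x′ y y′ → p :* (x :+ x′) :+ q :* (y :+ y′) :=
                       (p :* x :+ q :* y) :+ (p :* x′ :+ q :* y′))
    refl p (1# - p) x x′ y y′

  mix-nonNeg : ∀ {p x y} → 0# ≤ p → p ≤ 1# → 0# ≤ x → 0# ≤ y → 0# ≤ mix p x y
  mix-nonNeg {p} {x} {y} 0≤p p≤1 0≤x 0≤y = subst (_≤ mix p x y) (mix-const p 0#) (mix-mono 0≤p p≤1 0≤x 0≤y)

  -- An answer may name an out-neighbor of this vertex, but it depends only on the row and the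
  -- right-hand side at this vertex. This locality is what allows runs on different paths to be
  -- compared.
  loc : ∀ {n} → Query n → Fin n
  loc (vertex v)     = v
  loc (neighbor v _) = v
  loc (randomWalk v) = v

-- The linear system of a directed graph with out-degrees at most one, given by
-- its successor function.
module FunctionalGraph (ℛ : Reals) (w : Reals.Carrier ℛ) (0<w : Reals._<_ ℛ (Reals.0# ℛ) w) {n : ℕ} where
  open Reals ℛ
  open LinearSystems ℛ
  open OrderedField ℛ
  open Probability ℛ

  Successor : Set
  Successor = Fin n → Maybe (Fin n)

  -- The smallest non-negative entries allowed by 1-diagonal dominance, which therefore holds with
  -- equality in every row.
  diag : Maybe (Fin n) → Carrier
  diag nothing  = 1#
  diag (just _) = 1# + w

  weight : Maybe (Fin n) → Carrier
  weight nothing  = 0#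
  weight (just _) = w

  arc : Maybe (Fin n) → Vector n
  arc nothing  _ = 0#
  arc (just y)   = single y (- w)

  matrix : Successor → Matrix n
  matrix N v v′ = if does (v ≟ᶠ v′) then diag (N v) else arc (N v) v′

  -- With at most one out-neighbor, a neighbor list has a single ordering and a random walk step a
  -- single outcome. Every answer is thus deterministic and can be read off `N` and `b`.
  response : Successor → Vector n → (q : Query n) → Response q
  response N b (vertex v)     = length (fromMaybe (N v)) , weight (N v) , diag (N v) , b v
  response N b (neighbor v i) = head (drop i (fromMaybe (N v)))
  response N b (randomWalk v) = Maybe.map (λ y → y , - w) (N v)

  response-cong : ∀ {N N′ b b′} q → N (loc q) ≡ N′ (loc q) → b (loc q) ≡ b′ (loc q) →
                  response N b q ≡ response N′ b′ q
  response-cong (vertex v)     eq eq′ rewrite eq | eq′ = refl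
  response-cong (neighbor v i) eq eq′ rewrite eq = refl
  response-cong (randomWalk v) eq eq′ rewrite eq = refl

  private
    0≤w : 0# ≤ w
    0≤w = proj₁ 0<w

    w≢0 : w ≢ 0#
    w≢0 = proj₂ 0<w ∘ sym

    0≤1+w : 0# ≤ 1# + w
    0≤1+w = +-nonNeg 0≤1 0≤w

  -w≢0 : - w ≢ 0#
  -w≢0 -w≡0 = w≢0 (trans (sym (+-identityʳ w)) (trans (cong (w +_) (sym -w≡0)) (-‿inverseʳ w)))

  canonicalOrdering : (S : Matrix n) → NeighborOrdering S
  canonicalOrdering S = record { neighbors = outNeighbors S ; ordering = λ _ → ↭-refl }

  module _ (N : Successor) (irreflexive : ∀ v → N v ≢ just v) where

    private S = matrix N

    S-diagonal : ∀ v → S v v ≡ diag (N v)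
    S-diagonal v = if-yes (v ≟ᶠ v) refl

    S-off-diagonal : ∀ {v v′ m} → N v ≡ m → v ≢ v′ → S v v′ ≡ arc m v′
    S-off-diagonal {v} {v′} refl = if-no (v ≟ᶠ v′)

    ∣S-diagonal∣ : ∀ v → ∣ S v v ∣ ≡ diag (N v)
    ∣S-diagonal∣ v rewrite S-diagonal v with N v
    ... | nothing = 0≤x⇒∣x∣≡x 0≤1
    ... | just _  = 0≤x⇒∣x∣≡x 0≤1+w

    arc-self : ∀ v {y} → N v ≡ just y → y ≢ v
    arc-self v Nv≡y y≡v = irreflexive v (trans Nv≡y (cong just y≡v))

    S-arc : ∀ {v y} → N v ≡ just y → S v y ≡ - w
    S-arc {v} {y} eq = trans (S-off-diagonal eq (arc-self v eq ∘ sym)) (if-yes (y ≟ᶠ y) refl)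

    -- The value of `N v` is passed as `m` together with an equation, so that it can be matched on
    -- while the matrix still refers to `N v`.
    outNeighbors≡ : ∀ {v} m → N v ≡ m → outNeighbors S v ≡ fromMaybe m
    outNeighbors≡ nothing  eq = filter-none _ (tabulate⁺ {n = n} {f = id} λ v′ (v≢v′ , Svv′≢0) →
      Svv′≢0 (S-off-diagonal eq v≢v′))
    outNeighbors≡ {v} (just y) eq = filter-tabulate _ id y
      (arc-self v eq ∘ sym , λ Svy≡0 → -w≢0 (trans (sym (S-arc eq)) Svy≡0)) unique
      where
      unique : ∀ v′ → (v ≢ v′) × (S v v′ ≢ 0#) → y ≡ v′
      unique v′ (v≢v′ , Svv′≢0) = decidable-stable (y ≟ᶠ v′) λ y≢v′ →
        Svv′≢0 (trans (S-off-diagonal eq v≢v′) (if-no (y ≟ᶠ v′) y≢v′))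

    dᵒᵘᵗ≡ : ∀ {v} m → N v ≡ m → dᵒᵘᵗ S v ≡ weight m
    dᵒᵘᵗ≡ {v} nothing eq = trans (sum-cong-≗ term) (sum-replicate-zero n)
      where
      term : ∀ v′ → (if does (v ≟ᶠ v′) then 0# else ∣ S v v′ ∣) ≡ 0#
      term v′ with v ≟ᶠ v′
      ... | yes _ = refl
      ... | no  _ rewrite eq = 0≤x⇒∣x∣≡x ≤-refl
    dᵒᵘᵗ≡ {v} (just y) eq = trans (sum-cong-≗ term) (sum-single y w)
      where
      term : ∀ v′ → (if does (v ≟ᶠ v′) then 0# else ∣ S v v′ ∣) ≡ single y w v′
      term v′ with v ≟ᶠ v′
      ... | yes refl = sym (if-no (y ≟ᶠ v) (arc-self v eq))
      ... | no  _ rewrite eq with y ≟ᶠ v′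
      ...   | yes _ = ∣-x∣≡x 0≤w
      ...   | no  _ = 0≤x⇒∣x∣≡x ≤-refl

    walk≡ : ∀ b {v} m → N v ≡ m → Oracle.walk S b (canonicalOrdering S) v (fromMaybe m)
                                  ≡ pure (Maybe.map (λ y → y , - w) m)
    walk≡ b nothing  eq = refl
    walk≡ b {v} (just y) eq = cong [_] (cong₂ _,_ weighted (cong (λ a → just (y , a)) (S-arc eq)))
      where
      weighted : ∣ S v y ∣ * dᵒᵘᵗ S v ⁻¹ ≡ 1#
      weighted = begin-equality
        ∣ S v y ∣ * dᵒᵘᵗ S v ⁻¹ ≡⟨ cong₂ (λ a d → ∣ a ∣ * d ⁻¹) (S-arc eq) (dᵒᵘᵗ≡ (just y) eq) ⟩
        ∣ - w ∣ * w ⁻¹          ≡⟨ cong (_* w ⁻¹) (∣-x∣≡x 0≤w) ⟩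
        w * w ⁻¹                ≡⟨ ⁻¹-inverseʳ w w≢0 ⟩
        1#                      ∎

    answer≡ : ∀ b q → Oracle.answer S b (canonicalOrdering S) q ≡ pure (response N b q)
    answer≡ b (vertex v)
      rewrite outNeighbors≡ (N v) refl | dᵒᵘᵗ≡ (N v) refl | S-diagonal v = refl
    answer≡ b (neighbor v i) rewrite outNeighbors≡ (N v) refl = refl
    answer≡ b (randomWalk v) rewrite outNeighbors≡ (N v) refl = walk≡ b (N v) refl

    dominant : DiagonallyDominant₁ S
    dominant v rewrite dᵒᵘᵗ≡ (N v) refl | ∣S-diagonal∣ v with N v
    ... | nothing = ≤-reflexive (+-identityʳ 1#)
    ... | just _  = ≤-refl

    Δmax≤1 : Δmax S ℕ.≤ 1
    Δmax≤1 = ℕ-Extrema.max≤v⁺ z≤n (map⁺ (tabulate⁺ Δ≤1))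
      where
      Δ≤1 : ∀ v → Δᵒᵘᵗ S v ℕ.≤ 1
      Δ≤1 v rewrite outNeighbors≡ (N v) refl with N v
      ... | nothing = z≤n
      ... | just _  = s≤s z≤n

    Smax≡ : ∀ {v y} → N v ≡ just y → Smax S ≡ 1# + w
    Smax≡ {v} eq = Extrema.max≈v⁺ totalOrder
      (subst (λ a → a ∈ map (λ i → ∣ S i i ∣) (allFin n)) ∣Svv∣≡ (∈-map⁺ (λ i → ∣ S i i ∣) (∈-allFin v)))
      -- The last argument compares the maximum with the default value `0#` in `Smax`.
      (map⁺ (tabulate⁺ bound)) 0≤1+w
      where
      ∣Svv∣≡ : ∣ S v v ∣ ≡ 1# + w
      ∣Svv∣≡ = trans (∣S-diagonal∣ v) (cong diag eq)
      bound : ∀ i → ∣ S i i ∣ ≤ 1# + w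
      bound i rewrite ∣S-diagonal∣ i with N i
      ... | nothing = x≤x+y 0≤w
      ... | just _  = ≤-refl

    sink-row : ∀ {v} → N v ≡ nothing → ∀ z → (S · z) v ≡ z v
    sink-row {v} eq z = trans (sum-cong-≗ term) (sum-single v (z v))
      where
      term : ∀ v′ → S v v′ * z v′ ≡ single v (z v) v′
      term v′ with v ≟ᶠ v′
      ... | yes refl rewrite eq = *-identityˡ (z v)
      ... | no  _    rewrite eq = zeroˡ (z v′)

    arc-row : ∀ {v y} → N v ≡ just y → ∀ z → (S · z) v ≡ (1# + w) * z v + - w * z y
    arc-row {v} {y} eq z = begin-equality
      (S · z) v                                  ≡⟨ sum-cong-≗ term ⟩
      sum (λ v′ → single v a v′ + single y c v′) ≡⟨ ∑-distrib-+ (single v a) (single y c) ⟩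
      sum (single v a) + sum (single y c)        ≡⟨ cong₂ _+_ (sum-single v a) (sum-single y c) ⟩
      a + c                                      ∎
      where
      a c : Carrier
      a = (1# + w) * z v
      c = - w * z y
      term : ∀ v′ → S v v′ * z v′ ≡ single v a v′ + single y c v′
      term v′ with v ≟ᶠ v′
      ... | yes refl rewrite eq | if-no {a = c} {0#} (y ≟ᶠ v) (arc-self v eq) = sym (+-identityʳ a)
      ... | no  _ rewrite eq with y ≟ᶠ v′
      ...   | yes refl = sym (+-identityˡ c)
      ...   | no  _    = trans (zeroˡ (z v′)) (sym (+-identityˡ 0#))

    private
      π = canonicalOrdering S

    -- The answer distribution is a point mass by `answer≡`, so a query only selects a subtree and
    -- advances the counter.
    Pr-query : ∀ b q k {P : Pred (Carrier × ℕ) 0ℓ} (P? : Decidable P) →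
               Pr (run S b π (query q k)) P? ≡ Pr (run S b π (k (response N b q))) (P? ∘ tick)
    Pr-query b q k P? rewrite answer≡ b q = begin-equality
      Pr (scale 1# d ++ []) P? ≡⟨ cong (λ e → Pr e P?) (++-identityʳ (scale 1# d)) ⟩
      Pr (scale 1# d) P?       ≡⟨ Pr-scale 1# d P? ⟩
      1# * Pr d P?             ≡⟨ *-identityˡ (Pr d P?) ⟩
      Pr d P?                  ≡⟨ Pr-tick (run S b π (k (response N b q))) P? ⟩
      Pr (run S b π (k (response N b q))) (P? ∘ tick) ∎
      where
      d = map (λ (p , z , t) → p , z , suc t) (run S b π (k (response N b q)))

    Pr-toss : ∀ b p 0≤p p≤1 𝒜 ℬ {P : Pred (Carrier × ℕ) 0ℓ} (P? : Decidable P) →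
              Pr (run S b π (toss p 0≤p p≤1 𝒜 ℬ)) P? ≡
              mix p (Pr (run S b π 𝒜) P?) (Pr (run S b π ℬ) P?)
    Pr-toss b p _ _ 𝒜 ℬ P? =
      trans (Pr-++ (scale p (run S b π 𝒜)) (scale (1# - p) (run S b π ℬ)) P?)
            (cong₂ _+_ (Pr-scale p (run S b π 𝒜) P?) (Pr-scale (1# - p) (run S b π ℬ) P?))

    -- In effect, the weights of the outcomes of a run add up to one.
    Pr-certain : ∀ b 𝒜 {P : Pred (Carrier × ℕ) 0ℓ} (P? : Decidable P) → (∀ x → P x) →
                 Pr (run S b π 𝒜) P? ≡ 1#
    Pr-certain b (return z) P? always with P? (z , 0)
    ... | yes _ = +-identityʳ 1#
    ... | no ¬P = contradiction (always (z , 0)) ¬P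
    Pr-certain b (toss p 0≤p p≤1 𝒜 ℬ) P? always =
      trans (Pr-toss b p 0≤p p≤1 𝒜 ℬ P?)
     (trans (cong₂ (mix p) (Pr-certain b 𝒜 P? always) (Pr-certain b ℬ P? always)) (mix-const p 1#))
    Pr-certain b (query q k) P? always =
      trans (Pr-query b q k P?) (Pr-certain b (k (response N b q)) (P? ∘ tick) (always ∘ tick))

    Pr-bounds : ∀ b 𝒜 {P : Pred (Carrier × ℕ) 0ℓ} (P? : Decidable P) →
                0# ≤ Pr (run S b π 𝒜) P? × Pr (run S b π 𝒜) P? ≤ 1#
    Pr-bounds b (return z) P? with does (P? (z , 0))
    ... | true  = subst (λ a → 0# ≤ a × a ≤ 1#) (sym (+-identityʳ 1#)) (0≤1 , ≤-refl)
    ... | false = ≤-refl , 0≤1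
    Pr-bounds b (toss p 0≤p p≤1 𝒜 ℬ) P?
      rewrite Pr-toss b p 0≤p p≤1 𝒜 ℬ P?
      with Pr-bounds b 𝒜 P? | Pr-bounds b ℬ P?
    ... | 0≤x , x≤1 | 0≤y , y≤1 =
      mix-nonNeg 0≤p p≤1 0≤x 0≤y ,
      ≤-trans (mix-mono 0≤p p≤1 x≤1 y≤1) (≤-reflexive (mix-const p 1#))
    Pr-bounds b (query q k) P? rewrite Pr-query b q k P? =
      Pr-bounds b (k (response N b q)) (P? ∘ tick)

-- Expected visits to a vertex before another one is queried.

module HiddenPath (ℛ : Reals) (w : Reals.Carrier ℛ) (0<w : Reals._<_ ℛ (Reals.0# ℛ) w) {n : ℕ} where
  open Reals ℛ
  open LinearSystems ℛ
  open OrderedField ℛ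
  open Probability ℛ
  open FunctionalGraph ℛ w 0<w {n}

  b₀ : Vector n
  b₀ _ = 0#

  -- The expected number of the first T queries, made before the first query at
  -- s, that are located at t, when the successor function is N and b = 0.
  hits : Successor → Fin n → Fin n → ℕ → Algorithm n → Carrier
  hits N s t T       (return _)       = 0#
  hits N s t T       (toss p _ _ 𝒜 ℬ) = mix p (hits N s t T 𝒜) (hits N s t T ℬ)
  hits N s t zero    (query q k)      = 0#
  hits N s t (suc T) (query q k)      =
    single (loc q) 1# t +
    (if does (s ≟ᶠ loc q) then 0# else hits N s t T (k (response N b₀ q)))

  hits-nonNeg : ∀ N s t T 𝒜 → 0# ≤ hits N s t T 𝒜
  hits-nonNeg N s t T (return _) = ≤-refl
  hits-nonNeg N s t T (toss p 0≤p p≤1 𝒜 ℬ) =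
    mix-nonNeg 0≤p p≤1 (hits-nonNeg N s t T 𝒜) (hits-nonNeg N s t T ℬ)
  hits-nonNeg N s t zero (query q k) = ≤-refl
  hits-nonNeg N s t (suc T) (query q k) with s ≟ᶠ loc q
  ... | yes _ = +-nonNeg (single-nonNeg (loc q) t 0≤1) ≤-refl
  ... | no  _ = +-nonNeg (single-nonNeg (loc q) t 0≤1) (hits-nonNeg N s t T (k (response N b₀ q)))

  -- The current query is counted before the stopping test at `s`, so it remains only to see that
  -- the later visits contribute a non-negative amount.
  1≤hits-target : ∀ N s {t} T q k → loc q ≡ t → 1# ≤ hits N s t (suc T) (query q k)
  1≤hits-target N s {t} T q k w≡t = begin
    1#                      ≡⟨ if-yes (loc q ≟ᶠ t) w≡t ⟨
    single (loc q) 1# t     ≤⟨ x≤x+y rest-nonNeg ⟩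
    single (loc q) 1# t + rest ∎
    where
    rest : Carrier
    rest = if does (s ≟ᶠ loc q) then 0# else hits N s t T (k (response N b₀ q))
    rest-nonNeg : 0# ≤ rest
    rest-nonNeg with s ≟ᶠ loc q
    ... | yes _ = ≤-refl
    ... | no  _ = hits-nonNeg N s t T (k (response N b₀ q))

  sum-mix : ∀ p (f g : Vector n) → sum (λ i → mix p (f i) (g i)) ≡ mix p (sum f) (sum g)
  sum-mix p f g = trans (∑-distrib-+ (λ i → p * f i) (λ i → (1# - p) * g i))
    (sym (cong₂ _+_ (*-distribˡ-sum p f) (*-distribˡ-sum (1# - p) g)))

  -- Each query is located at exactly one vertex and so adds one to the sum. Stopping at `s` can
  -- only lower the total.
  sum-hits : ∀ N s T 𝒜 → sum (λ t → hits N s t T 𝒜) ≤ fromℕ T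
  sum-hits N s T (return _) =
    ≤-trans (≤-reflexive (sum-replicate-zero n)) (0≤fromℕ T)
  sum-hits N s T (toss p 0≤p p≤1 𝒜 ℬ) = begin
    sum (λ t → mix p (hits N s t T 𝒜) (hits N s t T ℬ))
      ≡⟨ sum-mix p (λ t → hits N s t T 𝒜) (λ t → hits N s t T ℬ) ⟩
    mix p (sum λ t → hits N s t T 𝒜) (sum λ t → hits N s t T ℬ)
      ≤⟨ mix-mono 0≤p p≤1 (sum-hits N s T 𝒜) (sum-hits N s T ℬ) ⟩
    mix p (fromℕ T) (fromℕ T)
      ≡⟨ mix-const p (fromℕ T) ⟩
    fromℕ T ∎
  sum-hits N s zero (query q k) = ≤-reflexive (sum-replicate-zero n)
  sum-hits N s (suc T) (query q k) = begin
    sum (λ t → single (loc q) 1# t + rest t)      ≡⟨ ∑-distrib-+ (single (loc q) 1#) rest ⟩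
    sum (single (loc q) 1#) + sum rest
      ≤⟨ +-mono-≤ (≤-reflexive (sum-single (loc q) 1#)) rest≤T ⟩
    1# + fromℕ T                                  ∎
    where
    rest : Vector n
    rest t = if does (s ≟ᶠ loc q) then 0# else hits N s t T (k (response N b₀ q))
    rest≤T : sum rest ≤ fromℕ T
    rest≤T with s ≟ᶠ loc q
    ... | yes _ = ≤-trans (≤-reflexive (sum-replicate-zero n)) (0≤fromℕ T)
    ... | no  _ = sum-hits N s T (k (response N b₀ q))

  -- The hidden path and the exact solution of its system.

  extend : Fin n → Fin n → Successor → Successor
  extend s y N v = if does (v ≟ᶠ s) then just y else N v

  path : (ℕ → Fin n) → ℕ → Successor
  path x zero    = λ _ → nothing
  path x (suc k) = extend (x k) (x (suc k)) (path x k)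

  Distinct : (ℕ → Fin n) → ℕ → Set
  Distinct x L = ∀ {i j} → i ℕ.< j → j ℕ.≤ L → x i ≢ x j

  module _ (x : ℕ → Fin n) where

    private N = path x

    path-support : ∀ k {v y} → N k v ≡ just y → ∃ λ i → i ℕ.< k × v ≡ x i × y ≡ x (suc i)
    path-support (suc k) {v} eq with v ≟ᶠ x k
    ... | yes v≡xk = k , ℕₚ.≤-refl , v≡xk , sym (just-injective eq)
    ... | no  _ with path-support k eq
    ...   | i , i<k , rest = i , ℕₚ.m<n⇒m<1+n i<k , rest

    module _ (r : Carrier) where

      -- For distinct vertices this is `r ^ (k - i)` at `x i` and zero off the path. With
      -- `r = w / (1 + w)` it solves the system of the path whose right-hand side is the indicator
      -- of `x k`. Lengthening the path by one vertex multiplies all earlier values by `r`.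
      potential : ℕ → Vector n
      potential zero    = single (x 0) 1#
      potential (suc k) v = if does (x (suc k) ≟ᶠ v) then 1# else r * potential k v

      potential-end : ∀ k → potential k (x k) ≡ 1#
      potential-end zero    = if-yes (x 0 ≟ᶠ x 0) refl
      potential-end (suc k) = if-yes (x (suc k) ≟ᶠ x (suc k)) refl

      module _ {L : ℕ} (distinct : Distinct x L) where

        potential-start : ∀ {k} → k ℕ.≤ L → potential k (x 0) ≡ r ^ k
        potential-start {zero}  _     = potential-end 0
        potential-start {suc k} 1+k≤L =
          trans (if-no (x (suc k) ≟ᶠ x 0) (distinct (s≤s z≤n) 1+k≤L ∘ sym))
                (cong (r *_) (potential-start (ℕₚ.<⇒≤ 1+k≤L)))

        -- Extending the path scales the values at both ends of an earlier arc by the same `r`, so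
        -- only the new last arc needs a computation.
        potential-arc : ∀ {k v y} → k ℕ.≤ L → N k v ≡ just y → potential k v ≡ r * potential k y
        potential-arc {suc k} {v} 1+k≤L eq with v ≟ᶠ x k
        potential-arc {suc k} {v} 1+k≤L refl | yes refl = begin-equality
          potential (suc k) (x k)
            ≡⟨ if-no (x (suc k) ≟ᶠ x k) (distinct ℕₚ.≤-refl 1+k≤L ∘ sym) ⟩
          r * potential k (x k)             ≡⟨ cong (r *_) (potential-end k) ⟩
          r * 1#                            ≡⟨ cong (r *_) (potential-end (suc k)) ⟨
          r * potential (suc k) (x (suc k)) ∎
        ... | no _ with path-support k eq
        ...   | i , i<k , refl , refl = trans
          (if-no (x (suc k) ≟ᶠ x i) (distinct (ℕₚ.m<n⇒m<1+n i<k) 1+k≤L ∘ sym))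
          (cong (r *_) (begin-equality
          potential k (x i)             ≡⟨ potential-arc (ℕₚ.<⇒≤ 1+k≤L) eq ⟩
          r * potential k (x (suc i))
            ≡⟨ if-no (x (suc k) ≟ᶠ x (suc i)) (distinct (s≤s i<k) 1+k≤L ∘ sym) ⟨
          potential (suc k) (x (suc i)) ∎))

        potential-sink : ∀ {k v} → k ℕ.≤ L → N k v ≡ nothing → potential k v ≡ single (x k) 1# v
        potential-sink {zero}  _ _ = refl
        potential-sink {suc k} {v} 1+k≤L eq with v ≟ᶠ x k
        -- Since `x k` has stopped being a sink, `v` is a different sink of the shorter path. The
        -- earlier potential vanishes there, also after scaling by `r`.
        ... | no v≢xk = cong (λ a → if does (x (suc k) ≟ᶠ v) then 1# else a)
          (trans (cong (r *_) (trans (potential-sink (ℕₚ.<⇒≤ 1+k≤L) eq)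
                                     (if-no (x k ≟ᶠ v) (v≢xk ∘ sym))))
                 (zeroʳ r))

    -- The union bound over the path steps `j` to `j + d - 1`: the expected number of queries that
    -- jump ahead, reaching the next path vertex before the current one. Each term is evaluated on
    -- the path that ends at the current vertex, so it is fixed before any vertex beyond the next
    -- one is chosen.
    cost : ℕ → ℕ → ℕ → Algorithm n → Carrier
    cost j zero    T 𝒜 = 0#
    cost j (suc d) T 𝒜 = hits (N j) (x j) (x (suc j)) T 𝒜 + cost (suc j) d T 𝒜

    cost-nonNeg : ∀ j d T 𝒜 → 0# ≤ cost j d T 𝒜
    cost-nonNeg j zero    T 𝒜 = ≤-refl
    cost-nonNeg j (suc d) T 𝒜 =
      +-nonNeg (hits-nonNeg (N j) (x j) (x (suc j)) T 𝒜) (cost-nonNeg (suc j) d T 𝒜)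

    cost-toss : ∀ j d T p 0≤p p≤1 𝒜 ℬ →
                cost j d T (toss p 0≤p p≤1 𝒜 ℬ) ≡ mix p (cost j d T 𝒜) (cost j d T ℬ)
    cost-toss j zero    T p _ _ 𝒜 ℬ = sym (mix-const p 0#)
    cost-toss j (suc d) T p 0≤p p≤1 𝒜 ℬ =
      trans (cong (hits (N j) (x j) (x (suc j)) T (toss p 0≤p p≤1 𝒜 ℬ) +_)
                  (cost-toss (suc j) d T p 0≤p p≤1 𝒜 ℬ))
            (sym (mix-+ p _ _ _ _))

    cost-bound : ∀ {T 𝒜} c m L → (∀ k → k ℕ.< L → c * hits (N k) (x k) (x (suc k)) T 𝒜 ≤ m) →
                 ∀ d j → j ℕ.+ d ≡ L → c * cost j d T 𝒜 ≤ fromℕ d * m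
    cost-bound c m L bound zero    j _   = ≤-reflexive (trans (zeroʳ c) (sym (zeroˡ m)))
    cost-bound {T} {𝒜} c m L bound (suc d) j eq = begin
      c * (h + cost (suc j) d T 𝒜)      ≡⟨ distribˡ c h (cost (suc j) d T 𝒜) ⟩
      c * h + c * cost (suc j) d T 𝒜
        ≤⟨ +-mono-≤ (bound j (ℕₚ.m+n≤o⇒m≤o (suc j) (ℕₚ.≤-reflexive eq′)))
                                                  (cost-bound c m L bound d (suc j) eq′) ⟩
      m + fromℕ d * m                   ≡⟨ cong (_+ fromℕ d * m) (*-identityˡ m) ⟨
      1# * m + fromℕ d * m              ≡⟨ distribʳ m 1# (fromℕ d) ⟨
      (1# + fromℕ d) * m                ∎
      where
      h = hits (N j) (x j) (x (suc j)) T 𝒜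
      eq′ : suc j ℕ.+ d ≡ L
      eq′ = trans (sym (ℕₚ.+-suc j d)) eq

    -- Comparison of the runs with right-hand sides `b₀` and `b₁`.

    module _ {L : ℕ} (distinct : Distinct x L) where

      path-irreflexive : ∀ v → N L v ≢ just v
      path-irreflexive v eq with path-support L eq
      ... | i , i<L , v≡xi , v≡x[1+i] = distinct ℕₚ.≤-refl i<L (trans (sym v≡xi) v≡x[1+i])

      b₁ : Vector n
      b₁ = single (x L) 1#

      -- If x j has not been queried before, then either the query reaches the
      -- path ahead of x j and is counted by the cost, or its answer is the same
      -- for all the paths x 0 , … , x k with j ≤ k and for both right-hand sides.
      query-step : ∀ T q k d j → j ℕ.+ d ≡ L → loc q ≢ x j →
        1# ≤ cost j d (suc T) (query q k) ⊎
        (N j (loc q) ≡ N L (loc q) × loc q ≢ x L ×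
         cost j d T (k (response (N L) b₀ q)) ≤ cost j d (suc T) (query q k))
      query-step T q k zero j eq w≢xj =
        inj₂ (cong (λ i → N i (loc q)) j≡L , w≢xj ∘ (λ w≡ → trans w≡ (cong x (sym j≡L))) , ≤-refl)
        where
        j≡L : j ≡ L
        j≡L = trans (sym (ℕₚ.+-identityʳ j)) eq
      query-step T q k (suc d) j eq w≢xj = step (loc q ≟ᶠ x (suc j))
        where
        target≤cost : hits (N j) (x j) (x (suc j)) (suc T) (query q k) ≤
                      cost j (suc d) (suc T) (query q k)
        target≤cost = x≤x+y (cost-nonNeg (suc j) d (suc T) (query q k))
        hits≤ : N j (loc q) ≡ N L (loc q) →
                hits (N j) (x j) (x (suc j)) T (k (response (N L) b₀ q)) ≤
                hits (N j) (x j) (x (suc j)) (suc T) (query q k)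
        hits≤ Nw≡ with x j ≟ᶠ loc q
        ... | yes xj≡w = contradiction (sym xj≡w) w≢xj
        -- The stopping test at `x j` fails, so counting continues. It does so on the answer given
        -- by the path up to `x j`, which agrees with the answer given by the full path.
        ... | no  _    = ≤-trans
          (≤-reflexive (cong (hits (N j) (x j) (x (suc j)) T ∘ k)
                             (response-cong {b = b₀} {b₀} q (sym Nw≡) refl)))
          (x≤y+x (single-nonNeg (loc q) (x (suc j)) 0≤1))
        step : Dec (loc q ≡ x (suc j)) → _
        step (yes w≡x[1+j]) = inj₁ (≤-trans (1≤hits-target (N j) (x j) T q k w≡x[1+j]) target≤cost)
        step (no w≢x[1+j]) with query-step T q k d (suc j) (trans (sym (ℕₚ.+-suc j d)) eq) w≢x[1+j]
        ... | inj₁ 1≤cost = inj₁ (≤-trans 1≤cost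
                (x≤y+x (hits-nonNeg (N j) (x j) (x (suc j)) (suc T) (query q k))))
        ... | inj₂ (N[1+j]w≡ , w≢xL , cost≤) = inj₂ (Nw≡ , w≢xL , +-mono-≤ (hits≤ Nw≡) cost≤)
          where
          Nw≡ : N j (loc q) ≡ N L (loc q)
          Nw≡ = trans (sym (if-no (loc q ≟ᶠ x j) w≢xj)) N[1+j]w≡

      private
        π = canonicalOrdering (matrix (N L))

        run₀ run₁ : Algorithm n → Dist (Carrier × ℕ)
        run₀ = run (matrix (N L)) b₀ π
        run₁ = run (matrix (N L)) b₁ π

      Pr≤1 : ∀ b 𝒜 {P : Pred (Carrier × ℕ) 0ℓ} (P? : Decidable P) →
             Pr (run (matrix (N L)) b π 𝒜) P? ≤ 1#
      Pr≤1 b 𝒜 P? = proj₂ (Pr-bounds (N L) path-irreflexive b 𝒜 P?)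

      0≤Pr : ∀ b 𝒜 {P : Pred (Carrier × ℕ) 0ℓ} (P? : Decidable P) →
             0# ≤ Pr (run (matrix (N L)) b π 𝒜) P?
      0≤Pr b 𝒜 P? = proj₁ (Pr-bounds (N L) path-irreflexive b 𝒜 P?)

      -- Both probabilities on the left are at most one, so a cost of at least one makes the bound
      -- trivial.
      indistinguishable-if-hit : ∀ 𝒜 {C} {P Q R : Pred (Carrier × ℕ) 0ℓ}
        (P? : Decidable P) (Q? : Decidable Q) (R? : Decidable R) → 1# ≤ C →
        Pr (run₀ 𝒜) P? + Pr (run₁ 𝒜) Q? ≤ 1# + (C + Pr (run₀ 𝒜) R?)
      indistinguishable-if-hit 𝒜 P? Q? R? 1≤C = ≤-trans
        (+-mono-≤ (Pr≤1 b₀ 𝒜 P?) (Pr≤1 b₁ 𝒜 Q?))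
        (+-monoʳ-≤ 1# (≤-trans 1≤C (x≤x+y (0≤Pr b₀ 𝒜 R?))))

      -- The right-hand sides `b₀` and `b₁` differ only at `x L`. A query elsewhere gets the same
      -- answer in both systems, and both runs continue in the same subtree.
      indistinguishable-query : ∀ q k {C C′} {P Q R : Pred (Carrier × ℕ) 0ℓ}
        (P? : Decidable P) (Q? : Decidable Q) (R? : Decidable R) → loc q ≢ x L → C ≤ C′ →
        let 𝒜 = k (response (N L) b₀ q) in
        Pr (run₀ 𝒜) (P? ∘ tick) + Pr (run₁ 𝒜) (Q? ∘ tick) ≤ 1# + (C + Pr (run₀ 𝒜) (R? ∘ tick)) →
        Pr (run₀ (query q k)) P? + Pr (run₁ (query q k)) Q? ≤ 1# + (C′ + Pr (run₀ (query q k)) R?)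
      indistinguishable-query q k P? Q? R? w≢xL C≤C′ ih
        rewrite Pr-query (N L) path-irreflexive b₀ q k P?
              | Pr-query (N L) path-irreflexive b₁ q k Q?
              | Pr-query (N L) path-irreflexive b₀ q k R?
              | response-cong {N L} {N L} {b₁} {b₀} q refl (if-no (x L ≟ᶠ loc q) (w≢xL ∘ sym)) =
        ≤-trans ih (+-monoʳ-≤ 1# (+-monoˡ-≤ (Pr (run₀ (k (response (N L) b₀ q))) (R? ∘ tick)) C≤C′))

      -- Here x 0 , … , x (j - 1) have been queried, and T queries are left
      -- for the d = L - j remaining steps of the path.
      indistinguishable : ∀ 𝒜 T j d → j ℕ.+ d ≡ L → T ℕ.≤ d →
        {P Q R : Pred (Carrier × ℕ) 0ℓ} (P? : Decidable P) (Q? : Decidable Q) (R? : Decidable R) →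
        (∀ {y} → P y → ¬ Q y) → (∀ z t → T ℕ.≤ t → R (z , t)) →
        Pr (run₀ 𝒜) P? + Pr (run₁ 𝒜) Q? ≤ 1# + (cost j d T 𝒜 + Pr (run₀ 𝒜) R?)
      -- Both runs return the same `z` without a query, and this outcome lies in at most one of the
      -- disjoint events.
      indistinguishable (return z) T j d _ _ P? Q? R? disjoint _ =
        ≤-trans disjoint≤1 (x≤x+y (+-nonNeg (cost-nonNeg j d T (return z)) (0≤Pr b₀ (return z) R?)))
        where
        disjoint≤1 : Pr (run₀ (return z)) P? + Pr (run₁ (return z)) Q? ≤ 1#
        disjoint≤1 with P? (z , 0) | Q? (z , 0)
        ... | yes p | yes q = contradiction q (disjoint p)
        ... | yes _ | no  _ = ≤-reflexive (trans (+-identityʳ (1# + 0#)) (+-identityʳ 1#))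
        ... | no  _ | yes _ = ≤-reflexive (trans (+-identityˡ (1# + 0#)) (+-identityʳ 1#))
        ... | no  _ | no  _ = ≤-trans (≤-reflexive (+-identityˡ 0#)) 0≤1
      indistinguishable (toss p 0≤p p≤1 𝒜 ℬ) T j d j+d≡L T≤d P? Q? R? disjoint late
        rewrite Pr-toss (N L) path-irreflexive b₀ p 0≤p p≤1 𝒜 ℬ P?
              | Pr-toss (N L) path-irreflexive b₁ p 0≤p p≤1 𝒜 ℬ Q?
              | Pr-toss (N L) path-irreflexive b₀ p 0≤p p≤1 𝒜 ℬ R?
              | cost-toss j d T p 0≤p p≤1 𝒜 ℬ = begin
        mix p (Pr (run₀ 𝒜) P?) (Pr (run₀ ℬ) P?) + mix p (Pr (run₁ 𝒜) Q?) (Pr (run₁ ℬ) Q?)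
          ≡⟨ mix-+ p _ _ _ _ ⟨
        mix p (Pr (run₀ 𝒜) P? + Pr (run₁ 𝒜) Q?) (Pr (run₀ ℬ) P? + Pr (run₁ ℬ) Q?)
          ≤⟨ mix-mono 0≤p p≤1 (indistinguishable 𝒜 T j d j+d≡L T≤d P? Q? R? disjoint late)
                              (indistinguishable ℬ T j d j+d≡L T≤d P? Q? R? disjoint late) ⟩
        mix p (1# + (cost j d T 𝒜 + Pr (run₀ 𝒜) R?)) (1# + (cost j d T ℬ + Pr (run₀ ℬ) R?))
          ≡⟨ mix-+ p _ _ _ _ ⟩
        mix p 1# 1# + mix p (cost j d T 𝒜 + Pr (run₀ 𝒜) R?) (cost j d T ℬ + Pr (run₀ ℬ) R?)
          ≡⟨ cong₂ _+_ (mix-const p 1#) (mix-+ p _ _ _ _) ⟩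
        1# + (mix p (cost j d T 𝒜) (cost j d T ℬ) + mix p (Pr (run₀ 𝒜) R?) (Pr (run₀ ℬ) R?)) ∎
      -- The budget is exhausted, so `R` holds for every outcome and its probability one absorbs the
      -- excess.
      indistinguishable (query q k) zero j d _ _ P? Q? R? _ late = begin
        Pr (run₀ (query q k)) P? + Pr (run₁ (query q k)) Q?
          ≤⟨ +-mono-≤ (Pr≤1 b₀ (query q k) P?) (Pr≤1 b₁ (query q k) Q?) ⟩
        1# + 1#
          ≡⟨ cong (1# +_) (Pr-certain (N L) path-irreflexive b₀ (query q k) R? (λ (z , t) → late z t z≤n)) ⟨
        1# + Pr (run₀ (query q k)) R?
          ≤⟨ +-monoʳ-≤ 1# (x≤y+x (cost-nonNeg j d zero (query q k))) ⟩
        1# + (cost j d zero (query q k) + Pr (run₀ (query q k)) R?) ∎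
      -- A positive budget forces a positive remaining length because `T ≤ d`; hence `x j` is not
      -- yet the end of the path. A query away from `x j` uses up budget but leaves `j` and the
      -- length unchanged.
      indistinguishable (query q k) (suc T) j (suc d) j+d≡L (s≤s T≤d) P? Q? R? disjoint late
        with loc q ≟ᶠ x j
      ... | no w≢xj with query-step T q k (suc d) j j+d≡L w≢xj
      ...   | inj₁ 1≤cost = indistinguishable-if-hit (query q k) P? Q? R? 1≤cost
      ...   | inj₂ (_ , w≢xL , cost≤) = indistinguishable-query q k P? Q? R? w≢xL cost≤
        (indistinguishable (k (response (N L) b₀ q)) T j (suc d) j+d≡L (ℕₚ.m≤n⇒m≤1+n T≤d)
           (P? ∘ tick) (Q? ∘ tick) (R? ∘ tick) disjoint (λ z t T≤t → late z (suc t) (s≤s T≤t)))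
      -- A query at `x j` itself advances the path: budget and remaining length both drop by one,
      -- and the cost term for reaching `x (suc j)` before `x j` is discarded.
      indistinguishable (query q k) (suc T) j (suc d) j+d≡L (s≤s T≤d) P? Q? R? disjoint late
          | yes w≡xj with query-step T q k d (suc j) eq w≢x[1+j]
        where
        eq : suc j ℕ.+ d ≡ L
        eq = trans (sym (ℕₚ.+-suc j d)) j+d≡L
        w≢x[1+j] : loc q ≢ x (suc j)
        w≢x[1+j] w≡x[1+j] = distinct ℕₚ.≤-refl
          (ℕₚ.m+n≤o⇒m≤o (suc j) (ℕₚ.≤-reflexive eq)) (trans (sym w≡xj) w≡x[1+j])
      ...   | inj₁ 1≤cost = indistinguishable-if-hit (query q k) P? Q? R?
        (≤-trans 1≤cost (x≤y+x (hits-nonNeg (N j) (x j) (x (suc j)) (suc T) (query q k))))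
      ...   | inj₂ (_ , w≢xL , cost≤) = indistinguishable-query q k P? Q? R? w≢xL
        (≤-trans cost≤ (x≤y+x (hits-nonNeg (N j) (x j) (x (suc j)) (suc T) (query q k))))
        (indistinguishable (k (response (N L) b₀ q)) T (suc j) d
           (trans (sym (ℕₚ.+-suc j d)) j+d≡L) T≤d
           (P? ∘ tick) (Q? ∘ tick) (R? ∘ tick) disjoint (λ z t T≤t → late z (suc t) (s≤s T≤t)))

-- Integer and real square roots.

⌊√n/4⌋ : ∀ n → ∃ λ L → 16 ℕ.* (L ℕ.* L) ℕ.≤ n × n ℕ.< 16 ℕ.* (suc L ℕ.* suc L)
⌊√n/4⌋ zero = 0 , z≤n , s≤s z≤n
⌊√n/4⌋ (suc n) with ⌊√n/4⌋ n
... | L , lower , upper with suc n ℕₚ.<? 16 ℕ.* (suc L ℕ.* suc L)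
...   | yes n< = L , ℕₚ.m≤n⇒m≤1+n lower , n<
-- The old upper bound says that `suc n` is at most `16 (L + 1)²`, so raising the root by one is
-- enough.
...   | no  n≮ = suc L , ℕₚ.≮⇒≥ n≮ , ℕₚ.≤-<-trans upper
          (ℕₚ.*-monoʳ-< 16 (ℕₚ.*-mono-< (ℕₚ.n<1+n (suc L)) (ℕₚ.n<1+n (suc L))))

module Constants (ℛ : Reals) where
  open Reals ℛ
  open OrderedField ℛ

  private variable x y z : Carrier

  *-cancelˡ-≤ : 0# < z → z * x ≤ z * y → x ≤ y
  *-cancelˡ-≤ {z} {x} {y} (0≤z , 0≢z) zx≤zy =
    subst₂ _≤_ (cancel x) (cancel y) (*-monoʳ-≤ (proj₁ (⁻¹-positive (0≤z , 0≢z))) zx≤zy)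
    where
    cancel : ∀ a → z ⁻¹ * (z * a) ≡ a
    cancel a = begin-equality
      z ⁻¹ * (z * a) ≡⟨ *-assoc (z ⁻¹) z a ⟨
      z ⁻¹ * z * a   ≡⟨ cong (_* a) (trans (*-comm (z ⁻¹) z) (⁻¹-inverseʳ z (0≢z ∘ sym))) ⟩
      1# * a         ≡⟨ *-identityˡ a ⟩
      a              ∎

  fromℕ-⁻¹-cancel : ∀ k m → fromℕ (suc k) ⁻¹ * fromℕ (suc k ℕ.* m) ≡ fromℕ m
  fromℕ-⁻¹-cancel k m = begin-equality
    a ⁻¹ * fromℕ (suc k ℕ.* m) ≡⟨ cong (a ⁻¹ *_) (fromℕ-* (suc k) m) ⟩
    a ⁻¹ * (a * fromℕ m)       ≡⟨ *-assoc (a ⁻¹) a (fromℕ m) ⟨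
    a ⁻¹ * a * fromℕ m
      ≡⟨ cong (_* fromℕ m) (trans (*-comm (a ⁻¹) a) (fromℕ-suc-inverse k)) ⟩
    1# * fromℕ m               ≡⟨ *-identityˡ (fromℕ m) ⟩
    fromℕ m                    ∎
    where
    a = fromℕ (suc k)

  √-lower : ∀ m {n} → m ℕ.* m ℕ.≤ n → fromℕ m ≤ √ n
  √-lower m {n} m²≤n = proj₁ (proj₂ (√-supremum n)) (fromℕ m)
    (subst (_≤ fromℕ n) (fromℕ-* m m) (fromℕ-mono m²≤n))

  -- The root is a least upper bound, so it suffices that `m` is an upper bound. Any `x` above `m`
  -- with `x² ≤ n` would give `m² ≤ n`.
  √-upper : ∀ m {n} → n ℕ.< m ℕ.* m → √ n ≤ fromℕ m
  √-upper m {n} n<m² = proj₂ (proj₂ (√-supremum n)) (fromℕ m) bound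
    where
    bound : ∀ x → x * x ≤ fromℕ n → x ≤ fromℕ m
    bound x x²≤n with total x (fromℕ m)
    ... | inj₁ x≤m = x≤m
    ... | inj₂ m≤x = contradiction n<m² (ℕₚ.≤⇒≯ (fromℕ-cancel-≤ (begin
      fromℕ (m ℕ.* m)   ≡⟨ fromℕ-* m m ⟩
      fromℕ m * fromℕ m ≤⟨ *-monoʳ-≤ (0≤fromℕ m) m≤x ⟩
      fromℕ m * x       ≤⟨ *-monoˡ-≤ (≤-trans (0≤fromℕ m) m≤x) m≤x ⟩
      x * x             ≤⟨ x²≤n ⟩
      fromℕ n           ∎)))

  double : ∀ a → a + a ≡ fromℕ 2 * a
  double a = begin-equality
    a + a              ≡⟨ cong₂ _+_ (*-identityˡ a) (*-identityˡ a) ⟨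
    1# * a + 1# * a    ≡⟨ distribʳ a 1# 1# ⟨
    (1# + 1#) * a      ≡⟨ cong (λ e → (1# + e) * a) fromℕ-1 ⟨
    fromℕ 2 * a        ∎

-- Greedy choice of the path vertices against a given algorithm.

module Greedy (ℛ : Reals) (w : Reals.Carrier ℛ) (0<w : Reals._<_ ℛ (Reals.0# ℛ) w) {m : ℕ}
              (𝒜 : LinearSystems.Algorithm ℛ (suc m)) (T : ℕ) (u : Fin (suc m)) where
  open Reals ℛ
  open LinearSystems ℛ
  open OrderedField ℛ
  open FunctionalGraph ℛ w 0<w {suc m}
  open HiddenPath ℛ w 0<w {suc m}

  record Prefix : Set where
    field
      tip       : Fin (suc m)
      successor : Successor
      visits    : Vector (suc m)
  open Prefix

  -- Adding `visits`, the number of earlier occurrences of `v` on the path, penalizes repetition.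
  -- The minimum can then be taken over all vertices: a repeated one has badness at least one, while
  -- the average is at most `(T + k + 1) / n` after `k` steps.
  badness : Prefix → Vector (suc m)
  badness p v = hits (successor p) (tip p) v T 𝒜 + visits p v

  best : ∀ p → ∃ λ y → fromℕ (suc m) * badness p y ≤ fromℕ T + sum (visits p)
  best p = pigeonhole (badness p) (begin
    sum (badness p)
      ≡⟨ ∑-distrib-+ (λ v → hits (successor p) (tip p) v T 𝒜) (visits p) ⟩
    sum (λ v → hits (successor p) (tip p) v T 𝒜) + sum (visits p)
      ≤⟨ +-monoˡ-≤ (sum (visits p)) (sum-hits (successor p) (tip p) T 𝒜) ⟩
    fromℕ T + sum (visits p) ∎)

  prefix : ℕ → Prefix
  prefix zero = record { tip = u ; successor = λ _ → nothing ; visits = single u 1# }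
  prefix (suc k) = record
    { tip       = y
    ; successor = extend (tip (prefix k)) y (successor (prefix k))
    ; visits    = λ v → single y 1# v + visits (prefix k) v
    }
    where
    y = proj₁ (best (prefix k))

  vertices : ℕ → Fin (suc m)
  vertices k = tip (prefix k)

  -- A prefix carries its own successor function because `vertices`, and hence `path vertices`, is
  -- defined only from the finished recursion.
  successor≡path : ∀ k → successor (prefix k) ≡ path vertices k
  successor≡path zero    = refl
  successor≡path (suc k) = cong (extend (vertices k) (vertices (suc k))) (successor≡path k)

  sum-visits : ∀ k → sum (visits (prefix k)) ≡ fromℕ (suc k)
  sum-visits zero    = trans (sum-single u 1#) (sym fromℕ-1)
  sum-visits (suc k) = trans (∑-distrib-+ (single (vertices (suc k)) 1#) (visits (prefix k)))
    (cong₂ _+_ (sum-single (vertices (suc k)) 1#) (sum-visits k))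

  visits-nonNeg : ∀ k v → 0# ≤ visits (prefix k) v
  visits-nonNeg zero    v = single-nonNeg u v 0≤1
  visits-nonNeg (suc k) v = +-nonNeg (single-nonNeg (vertices (suc k)) v 0≤1) (visits-nonNeg k v)

  1≤visits : ∀ {i k} → i ℕ.≤ k → 1# ≤ visits (prefix k) (vertices i)
  1≤visits {k = zero} z≤n = ≤-reflexive (sym (if-yes (u ≟ᶠ u) refl))
  1≤visits {i} {suc k} i≤1+k with ℕₚ.m≤n⇒m<n∨m≡n i≤1+k
  ... | inj₁ (s≤s i≤k) = ≤-trans (1≤visits i≤k)
          (x≤y+x (single-nonNeg (vertices (suc k)) (vertices i) 0≤1))
  ... | inj₂ refl = ≤-trans (≤-reflexive (sym (if-yes (vertices i ≟ᶠ vertices i) refl)))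
          (x≤x+y (visits-nonNeg k (vertices i)))

  best-bound : ∀ k → fromℕ (suc m) * badness (prefix k) (vertices (suc k)) ≤ fromℕ (T ℕ.+ suc k)
  best-bound k = ≤-trans (proj₂ (best (prefix k)))
    (≤-reflexive (trans (cong (fromℕ T +_) (sum-visits k)) (sym (fromℕ-+ T (suc k)))))

  hits-bound : ∀ k → fromℕ (suc m) * hits (path vertices k) (vertices k) (vertices (suc k)) T 𝒜
                     ≤ fromℕ (T ℕ.+ suc k)
  hits-bound k rewrite sym (successor≡path k) = ≤-trans
    (*-monoʳ-≤ (0≤fromℕ (suc m)) (x≤x+y (visits-nonNeg k (vertices (suc k))))) (best-bound k)

  -- A repeated vertex would have been chosen with badness at least one, so that
  -- `n ≤ T + k + 1 ≤ T + L`.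
  vertices-distinct : ∀ {L} → T ℕ.+ L ℕ.< suc m → Distinct vertices L
  vertices-distinct T+L<n {i} {suc k} (s≤s i≤k) 1+k≤L xi≡x[1+k] =
    contradiction (ℕₚ.+-monoʳ-≤ T 1+k≤L) (ℕₚ.<⇒≱ (ℕₚ.<-≤-trans T+L<n n≤T+1+k))
    where
    n≤T+1+k : suc m ℕ.≤ T ℕ.+ suc k
    n≤T+1+k = fromℕ-cancel-≤ (begin
      fromℕ (suc m)         ≡⟨ *-identityʳ (fromℕ (suc m)) ⟨
      fromℕ (suc m) * 1#    ≤⟨ *-monoʳ-≤ (0≤fromℕ (suc m)) (≤-trans 1≤visited
                                 (x≤y+x (hits-nonNeg (successor (prefix k)) (vertices k) (vertices (suc k)) T 𝒜))) ⟩
      fromℕ (suc m) * badness (prefix k) (vertices (suc k)) ≤⟨ best-bound k ⟩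
      fromℕ (T ℕ.+ suc k)   ∎)
      where
      1≤visited : 1# ≤ visits (prefix k) (vertices (suc k))
      1≤visited = subst (λ v → 1# ≤ visits (prefix k) v) xi≡x[1+k] (1≤visits i≤k)

-- The weight, the error and the decay along the path.

module LowerBound (ℛ : Reals) {m ℓ : ℕ}
  (lower : 16 ℕ.* (suc ℓ ℕ.* suc ℓ) ℕ.≤ suc m)
  (upper : suc m ℕ.< 16 ℕ.* (suc (suc ℓ) ℕ.* suc (suc ℓ))) where
  open Reals ℛ
  open LinearSystems ℛ
  open OrderedField ℛ
  open Constants ℛ

  n L : ℕ
  n = suc m
  L = suc ℓ

  -- With `w = 2L - 1` the largest diagonal entry is `W = 2L`, of order `√n`, while one arc loses
  -- only the fraction `1 / (2L)` of the solution. The solution at the start is then at least one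
  -- half, which two errors of size `ε` cannot bridge.
  w W ε : Carrier
  w = fromℕ (suc (ℓ ℕ.+ ℓ))
  W = 1# + w
  ε = fromℕ 8 ⁻¹

  0<w : 0# < w
  0<w = fromℕ-suc-positive (ℓ ℕ.+ ℓ)

  W≡2L : W ≡ fromℕ (2 ℕ.* L)
  W≡2L = cong fromℕ (identity ℓ)
    where
    identity : ∀ ℓ → suc (suc (ℓ ℕ.+ ℓ)) ≡ 2 ℕ.* suc ℓ
    identity = solve-∀

  0<W : 0# < W
  0<W = fromℕ-suc-positive (suc (ℓ ℕ.+ ℓ))

  r s : Carrier
  r = w * W ⁻¹
  s = W ⁻¹

  W*s≡1 : W * s ≡ 1#
  W*s≡1 = ⁻¹-inverseʳ W (proj₂ 0<W ∘ sym)

  r+s≡1 : r + s ≡ 1#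
  r+s≡1 = begin-equality
    w * s + s        ≡⟨ cong (w * s +_) (*-identityˡ s) ⟨
    w * s + 1# * s   ≡⟨ distribʳ s w 1# ⟨
    (w + 1#) * s     ≡⟨ cong (_* s) (+-comm w 1#) ⟩
    W * s            ≡⟨ W*s≡1 ⟩
    1#               ∎

  0≤s : 0# ≤ s
  0≤s = proj₁ (⁻¹-positive 0<W)

  0≤r : 0# ≤ r
  0≤r = *-nonNeg (proj₁ 0<w) 0≤s

  W*r≡w : W * r ≡ w
  W*r≡w = begin-equality
    W * (w * s)  ≡⟨ solve 3 (λ a b c → a :* (b :* c) := b :* (a :* c)) refl W w s ⟩
    w * (W * s)  ≡⟨ cong (w *_) W*s≡1 ⟩
    w * 1#       ≡⟨ *-identityʳ w ⟩
    w            ∎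

  r≤1 : r ≤ 1#
  r≤1 = ≤-trans (x≤x+y 0≤s) (≤-reflexive r+s≡1)

  open FunctionalGraph ℛ w 0<w {n}
  open HiddenPath ℛ w 0<w {n}

  power-bounds : ∀ k → 0# ≤ r ^ k × r ^ k ≤ 1#
  power-bounds zero    = 0≤1 , ≤-refl
  power-bounds (suc k) with power-bounds k
  ... | 0≤r^k , r^k≤1 = *-nonNeg 0≤r 0≤r^k , (begin
    r * r ^ k ≤⟨ *-monoʳ-≤ 0≤r r^k≤1 ⟩
    r * 1#   ≡⟨ *-identityʳ r ⟩
    r        ≤⟨ r≤1 ⟩
    1#       ∎)

  -- Bernoulli's inequality for `r = 1 - s`, written without subtraction. In the induction step
  -- `r + s` replaces one, and `r ^ k ≤ 1` bounds the loss by `s`.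
  bernoulli : ∀ k → 1# ≤ r ^ k + fromℕ k * s
  bernoulli zero    = x≤x+y (≤-reflexive (sym (zeroˡ s)))
  bernoulli (suc k) = begin
    1#                                ≤⟨ bernoulli k ⟩
    r ^ k + fromℕ k * s                ≡⟨ cong (_+ fromℕ k * s) (*-identityˡ (r ^ k)) ⟨
    1# * r ^ k + fromℕ k * s           ≡⟨ cong (λ a → a * r ^ k + fromℕ k * s) r+s≡1 ⟨
    (r + s) * r ^ k + fromℕ k * s
      ≡⟨ solve 4 (λ r s p q → (r :+ s) :* p :+ q := r :* p :+ (s :* p :+ q))
           refl r s (r ^ k) (fromℕ k * s) ⟩
    r * r ^ k + (s * r ^ k + fromℕ k * s)
      ≤⟨ +-monoʳ-≤ (r * r ^ k) (+-monoˡ-≤ (fromℕ k * s)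
           (≤-trans (*-monoʳ-≤ 0≤s (proj₂ (power-bounds k))) (≤-reflexive (*-comm s 1#)))) ⟩
    r * r ^ k + (1# * s + fromℕ k * s) ≡⟨ cong (r * r ^ k +_) (distribʳ s 1# (fromℕ k)) ⟨
    r * r ^ k + (1# + fromℕ k) * s     ∎

  -- Two copies of Bernoulli's inequality lose `2 * L * s = W * s = 1` in total.
  1≤2r^L : 1# ≤ r ^ L + r ^ L
  1≤2r^L = +-cancelˡ-≤ 1# (begin
    1# + 1#                                   ≤⟨ +-mono-≤ (bernoulli L) (bernoulli L) ⟩
    (r ^ L + fromℕ L * s) + (r ^ L + fromℕ L * s)
      ≡⟨ solve 3 (λ a b s → (a :+ b :* s) :+ (a :+ b :* s) := (b :+ b) :* s :+ (a :+ a))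
           refl (r ^ L) (fromℕ L) s ⟩
    (fromℕ L + fromℕ L) * s + (r ^ L + r ^ L)   ≡⟨ cong (λ a → a * s + (r ^ L + r ^ L)) L+L≡W ⟩
    W * s + (r ^ L + r ^ L)                     ≡⟨ cong (_+ (r ^ L + r ^ L)) W*s≡1 ⟩
    1# + (r ^ L + r ^ L)                        ∎)
    where
    L+L≡W : fromℕ L + fromℕ L ≡ W
    L+L≡W = trans (double (fromℕ L)) (trans (sym (fromℕ-* 2 L)) (sym W≡2L))

  -- The hard systems: promise, solutions and their separation.

  module _ (x : ℕ → Fin n) (distinct : Distinct x L) where
    S : Matrix n
    S = matrix (path x L)

    Smax≡2L : Smax S ≡ fromℕ (2 ℕ.* L)
    Smax≡2L = trans (Smax≡ (path x L) (path-irreflexive x distinct) {x ℓ} {x (suc ℓ)}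
                       (if-yes (x ℓ ≟ᶠ x ℓ) refl)) W≡2L

    -- The largest diagonal entry is `2L`. From `upper`, `√n ≤ 4(L + 1) ≤ 8L`, which gives the
    -- constant one quarter; from `lower`, `(2L)² ≤ 16L² ≤ n`.
    promise : ∀ b → Boolean b → Promise (fromℕ 4 ⁻¹) 1# 1 S b
    promise b boolean = record
      { dominant = dominant (path x L) (path-irreflexive x distinct)
      ; Smax-Ω√n = begin
          fromℕ 4 ⁻¹ * √ n
            ≤⟨ *-monoʳ-≤ (proj₁ (⁻¹-positive (fromℕ-suc-positive 3))) (√-upper (4 ℕ.* (2 ℕ.* L)) n<[8L]²) ⟩
          fromℕ 4 ⁻¹ * fromℕ (4 ℕ.* (2 ℕ.* L)) ≡⟨ fromℕ-⁻¹-cancel 3 (2 ℕ.* L) ⟩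
          fromℕ (2 ℕ.* L)                      ≡⟨ Smax≡2L ⟨
          Smax S                               ∎
      ; Smax-O√n = begin
          Smax S              ≡⟨ Smax≡2L ⟩
          fromℕ (2 ℕ.* L)     ≤⟨ √-lower (2 ℕ.* L) [2L]²≤n ⟩
          √ n                 ≡⟨ *-identityˡ (√ n) ⟨
          1# * √ n            ∎
      ; Δmax-O1 = Δmax≤1 (path x L) (path-irreflexive x distinct)
      ; boolean = boolean
      }
      where
      n<[8L]² : n ℕ.< (4 ℕ.* (2 ℕ.* L)) ℕ.* (4 ℕ.* (2 ℕ.* L))
      n<[8L]² = ℕₚ.<-≤-trans upper (subst₂ ℕ._≤_ refl (identity ℓ)
                  (ℕₚ.*-monoʳ-≤ 16 (ℕₚ.*-mono-≤ 2+ℓ≤2L 2+ℓ≤2L)))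
        where
        2+ℓ≤2L : suc (suc ℓ) ℕ.≤ 2 ℕ.* L
        2+ℓ≤2L = s≤s (ℕₚ.≤-trans (ℕₚ.m≤n+m (suc ℓ) ℓ) (ℕₚ.+-monoʳ-≤ ℓ (ℕₚ.m≤m+n (suc ℓ) 0)))
        identity : ∀ ℓ → 16 ℕ.* ((2 ℕ.* suc ℓ) ℕ.* (2 ℕ.* suc ℓ)) ≡
                         (4 ℕ.* (2 ℕ.* suc ℓ)) ℕ.* (4 ℕ.* (2 ℕ.* suc ℓ))
        identity = solve-∀
      [2L]²≤n : (2 ℕ.* L) ℕ.* (2 ℕ.* L) ℕ.≤ n
      [2L]²≤n = ℕₚ.≤-trans (ℕₚ.≤-reflexive (identity ℓ))
        (ℕₚ.≤-trans (ℕₚ.*-monoˡ-≤ (suc ℓ ℕ.* suc ℓ) (ℕₚ.m≤m+n 4 12)) lower)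
        where
        identity : ∀ ℓ → (2 ℕ.* suc ℓ) ℕ.* (2 ℕ.* suc ℓ) ≡ 4 ℕ.* (suc ℓ ℕ.* suc ℓ)
        identity = solve-∀

    solution₀ : ∀ i → (S · b₀) i ≡ b₀ i
    solution₀ i = trans (sum-cong-≗ (λ j → zeroʳ (S i j))) (sum-replicate-zero n)

    z₁ : Vector n
    z₁ = potential x r L

    solution₁ : ∀ i → (S · z₁) i ≡ b₁ x distinct i
    solution₁ i = by-successor (path x L i) refl
      where
      by-successor : ∀ o → path x L i ≡ o → (S · z₁) i ≡ b₁ x distinct i
      by-successor nothing  eq = trans (sink-row (path x L) (path-irreflexive x distinct) eq z₁)
                                       (potential-sink x r distinct ℕₚ.≤-refl eq)
      by-successor (just y) eq = begin-equality
        (S · z₁) i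
          ≡⟨ arc-row (path x L) (path-irreflexive x distinct) eq z₁ ⟩
        W * z₁ i + - w * z₁ y
          ≡⟨ cong (λ a → W * a + - w * z₁ y) (potential-arc x r distinct ℕₚ.≤-refl eq) ⟩
        W * (r * z₁ y) + - w * z₁ y        ≡⟨ cong (_+ - w * z₁ y) (*-assoc W r (z₁ y)) ⟨
        W * r * z₁ y + - w * z₁ y          ≡⟨ cong (λ a → a * z₁ y + - w * z₁ y) W*r≡w ⟩
        w * z₁ y + - w * z₁ y              ≡⟨ distribʳ (z₁ y) w (- w) ⟨
        (w - w) * z₁ y                     ≡⟨ cong (_* z₁ y) (-‿inverseʳ w) ⟩
        0# * z₁ y                          ≡⟨ zeroˡ (z₁ y) ⟩
        0#                                 ≡⟨ off-end ⟨
        b₁ x distinct i                    ∎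
        where
        off-end : b₁ x distinct i ≡ 0#
        off-end with path-support x L eq
        ... | k , k<L , refl , _ = if-no (x L ≟ᶠ x k) (distinct k<L ℕₚ.≤-refl ∘ sym)

    z₁-start : z₁ (x 0) ≡ r ^ L
    z₁-start = potential-start x r distinct ℕₚ.≤-refl

    -- An output close to both would force the value at the start to be at most `2 * ε`, one
    -- quarter, although it is at least one half. Cleared of fractions, this reads `2 ≤ 8 * ε = 1`.
    disjoint : ∀ z → ∣ z - b₀ (x 0) ∣ ≤ ε → ¬ ∣ z - z₁ (x 0) ∣ ≤ ε
    disjoint z near₀ near₁ = contradiction (fromℕ-cancel-≤ {2} {1} (begin
      fromℕ 2                          ≡⟨ *-identityʳ (fromℕ 2) ⟨
      fromℕ 2 * 1#                     ≤⟨ *-monoʳ-≤ (0≤fromℕ 2) 1≤4ε ⟩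
      fromℕ 2 * (fromℕ 2 * (fromℕ 2 * ε))
        ≡⟨ solve 2 (λ a e → a :* (a :* (a :* e)) := a :* (a :* a) :* e) refl (fromℕ 2) ε ⟩
      fromℕ 2 * (fromℕ 2 * fromℕ 2) * ε
        ≡⟨ cong (_* ε) (trans (fromℕ-* 2 4) (cong (fromℕ 2 *_) (fromℕ-* 2 2))) ⟨
      fromℕ 8 * ε                      ≡⟨ fromℕ-suc-inverse 7 ⟩
      1#                               ≡⟨ fromℕ-1 ⟨
      fromℕ 1                          ∎)) λ { (s≤s ()) }
      where
      z₁≤2ε : z₁ (x 0) ≤ fromℕ 2 * ε
      z₁≤2ε = ≤-trans (y≤∣x-0∣+∣x-y∣ z (z₁ (x 0)))
             (≤-trans (+-mono-≤ near₀ near₁) (≤-reflexive (double ε)))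
      1≤4ε : 1# ≤ fromℕ 2 * (fromℕ 2 * ε)
      1≤4ε = begin
        1#                        ≤⟨ 1≤2r^L ⟩
        r ^ L + r ^ L               ≡⟨ cong₂ _+_ z₁-start z₁-start ⟨
        z₁ (x 0) + z₁ (x 0)       ≤⟨ +-mono-≤ z₁≤2ε z₁≤2ε ⟩
        fromℕ 2 * ε + fromℕ 2 * ε ≡⟨ double (fromℕ 2 * ε) ⟩
        fromℕ 2 * (fromℕ 2 * ε)   ∎

  -- From correctness of the algorithm to a long run.

  module _ (𝒜 : Fin n → Algorithm n) (solves : Solves 𝒜 ε (fromℕ 4 ⁻¹) 1# 1) where

    u : Fin n
    u = zero

    open Greedy ℛ w 0<w (𝒜 u) L u

    distinct : Distinct vertices L
    distinct = vertices-distinct (ℕₚ.<-≤-trans L+L<16L² lower)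
      where
      L+L<16L² : L ℕ.+ L ℕ.< 16 ℕ.* (L ℕ.* L)
      -- The underscore stands for the explicit slack `16L² - (2L + 1)`, a polynomial in `ℓ` with
      -- non-negative coefficients.
      L+L<16L² = ℕₚ.≤-trans (ℕₚ.m≤m+n (suc (L ℕ.+ L)) _) (ℕₚ.≤-reflexive (identity ℓ))
        where
        identity : ∀ ℓ →
          suc (suc ℓ ℕ.+ suc ℓ) ℕ.+ (13 ℕ.+ 30 ℕ.* ℓ ℕ.+ 16 ℕ.* (ℓ ℕ.* ℓ)) ≡ 16 ℕ.* (suc ℓ ℕ.* suc ℓ)
        identity = solve-∀

    hard : Matrix n
    hard = S vertices distinct

    π : NeighborOrdering hard
    π = canonicalOrdering hard

    C : Carrier
    C = cost vertices 0 L L (𝒜 u)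

    -- Each of the `L` terms of the cost is at most `2L / n`, and `8 * L * 2L = 16L² ≤ n`.
    8C≤1 : fromℕ 8 * C ≤ 1#
    8C≤1 = *-cancelˡ-≤ (fromℕ-suc-positive m) (begin
      fromℕ n * (fromℕ 8 * C)
        ≡⟨ solve 3 (λ a b c → a :* (b :* c) := b :* (a :* c)) refl (fromℕ n) (fromℕ 8) C ⟩
      fromℕ 8 * (fromℕ n * C)
        ≤⟨ *-monoʳ-≤ (0≤fromℕ 8) (cost-bound vertices (fromℕ n) (fromℕ (L ℕ.+ L)) L hits≤ L 0 refl) ⟩
      fromℕ 8 * (fromℕ L * fromℕ (L ℕ.+ L))
        ≡⟨ trans (fromℕ-* 8 (L ℕ.* (L ℕ.+ L))) (cong (fromℕ 8 *_) (fromℕ-* L (L ℕ.+ L))) ⟨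
      fromℕ (8 ℕ.* (L ℕ.* (L ℕ.+ L)))
        ≤⟨ fromℕ-mono (ℕₚ.≤-trans (ℕₚ.≤-reflexive (identity L)) lower) ⟩
      fromℕ n                     ≡⟨ *-identityʳ (fromℕ n) ⟨
      fromℕ n * 1#                ∎)
      where
      identity : ∀ L → 8 ℕ.* (L ℕ.* (L ℕ.+ L)) ≡ 16 ℕ.* (L ℕ.* L)
      identity = solve-∀
      hits≤ : ∀ k → k ℕ.< L → fromℕ n * hits (path vertices k) (vertices k) (vertices (suc k)) L (𝒜 u)
                              ≤ fromℕ (L ℕ.+ L)
      hits≤ k k<L = ≤-trans (hits-bound k) (fromℕ-mono (ℕₚ.+-monoʳ-≤ L k<L))

    -- If long runs had probability zero, then `4/3 ≤ P₀ + P₁ ≤ 1 + C ≤ 9/8`. Multiplied by 24, this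
    -- is `32 ≤ 27`.
    long-run-likely : 0# < Pr (run hard b₀ π (𝒜 u)) (λ (_ , t) → fromℕ 2 ⁻¹ * Smax hard ≤? fromℕ t)
    long-run-likely = 0≤Pr vertices distinct b₀ (𝒜 u) late? , λ 0≡late →
      contradiction (fromℕ-cancel-≤ {32} {27} (begin
        fromℕ 32                       ≡⟨ fromℕ-* 8 4 ⟩
        fromℕ 8 * fromℕ 4              ≤⟨ *-monoʳ-≤ (0≤fromℕ 8) (4≤3+3C (sym 0≡late)) ⟩
        fromℕ 8 * (fromℕ 3 + fromℕ 3 * C)
          ≡⟨ solve 3 (λ a b c → a :* (b :+ b :* c) := a :* b :+ b :* (a :* c)) refl (fromℕ 8) (fromℕ 3) C ⟩
        fromℕ 8 * fromℕ 3 + fromℕ 3 * (fromℕ 8 * C)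
          ≤⟨ +-monoʳ-≤ (fromℕ 8 * fromℕ 3) (*-monoʳ-≤ (0≤fromℕ 3) 8C≤1) ⟩
        fromℕ 8 * fromℕ 3 + fromℕ 3 * 1#  ≡⟨ cong₂ _+_ (sym (fromℕ-* 8 3)) (*-identityʳ (fromℕ 3)) ⟩
        fromℕ 24 + fromℕ 3             ≡⟨ fromℕ-+ 24 3 ⟨
        fromℕ 27                       ∎)) (from-no (32 ℕₚ.≤? 27))
      where
      late? : Decidable (λ ((_ , t) : Carrier × ℕ) → fromℕ 2 ⁻¹ * Smax hard ≤ fromℕ t)
      late? (_ , t) = fromℕ 2 ⁻¹ * Smax hard ≤? fromℕ t
      near : (z* : Vector n) → Decidable (λ ((z , _) : Carrier × ℕ) → ∣ z - z* u ∣ ≤ ε)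
      near z* (z , _) = ∣ z - z* u ∣ ≤? ε
      2/3 P₀ P₁ : Carrier
      2/3 = fromℕ 2 * fromℕ 3 ⁻¹
      P₀ = Pr (run hard b₀ π (𝒜 u)) (near b₀)
      P₁ = Pr (run hard (b₁ vertices distinct) π (𝒜 u)) (near (z₁ vertices distinct))
      late : ∀ z t → L ℕ.≤ t → fromℕ 2 ⁻¹ * Smax hard ≤ fromℕ t
      -- The budget of `L` queries is exactly half of the largest diagonal entry `2L`; this fixes
      -- the constant in the query bound.
      late z t L≤t = begin
        fromℕ 2 ⁻¹ * Smax hard         ≡⟨ cong (fromℕ 2 ⁻¹ *_) (Smax≡2L vertices distinct) ⟩
        fromℕ 2 ⁻¹ * fromℕ (2 ℕ.* L)   ≡⟨ fromℕ-⁻¹-cancel 1 L ⟩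
        fromℕ L                        ≤⟨ fromℕ-mono L≤t ⟩
        fromℕ t                        ∎
      2/3≤P₀ : 2/3 ≤ P₀
      2/3≤P₀ = solves hard b₀ (promise vertices distinct b₀ (λ _ → inj₁ refl)) π
                 b₀ (solution₀ vertices distinct) u
      boolean₁ : Boolean (b₁ vertices distinct)
      boolean₁ v with vertices L ≟ᶠ v
      ... | yes _ = inj₂ refl
      ... | no  _ = inj₁ refl
      2/3≤P₁ : 2/3 ≤ P₁
      2/3≤P₁ = solves hard (b₁ vertices distinct)
                 (promise vertices distinct (b₁ vertices distinct) boolean₁) π
                 (z₁ vertices distinct) (solution₁ vertices distinct) u
      4≤3+3C : Pr (run hard b₀ π (𝒜 u)) late? ≡ 0# → fromℕ 4 ≤ fromℕ 3 + fromℕ 3 * C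
      4≤3+3C late≡0 = begin
        fromℕ 4                         ≡⟨ fromℕ-+ 2 2 ⟩
        fromℕ 2 + fromℕ 2               ≡⟨ cong₂ _+_ 3*2/3≡2 3*2/3≡2 ⟨
        fromℕ 3 * 2/3 + fromℕ 3 * 2/3   ≡⟨ distribˡ (fromℕ 3) 2/3 2/3 ⟨
        fromℕ 3 * (2/3 + 2/3)           ≤⟨ *-monoʳ-≤ (0≤fromℕ 3) 2/3+2/3≤1+C ⟩
        fromℕ 3 * (1# + C)
          ≡⟨ trans (distribˡ (fromℕ 3) 1# C) (cong (_+ fromℕ 3 * C) (*-identityʳ (fromℕ 3))) ⟩
        fromℕ 3 + fromℕ 3 * C           ∎
        where
        3*2/3≡2 : fromℕ 3 * 2/3 ≡ fromℕ 2
        3*2/3≡2 = begin-equality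
          fromℕ 3 * (fromℕ 2 * fromℕ 3 ⁻¹)
            ≡⟨ solve 3 (λ a b c → a :* (b :* c) := b :* (a :* c)) refl (fromℕ 3) (fromℕ 2) (fromℕ 3 ⁻¹) ⟩
          fromℕ 2 * (fromℕ 3 * fromℕ 3 ⁻¹) ≡⟨ cong (fromℕ 2 *_) (fromℕ-suc-inverse 2) ⟩
          fromℕ 2 * 1#                     ≡⟨ *-identityʳ (fromℕ 2) ⟩
          fromℕ 2                          ∎
        2/3+2/3≤1+C : 2/3 + 2/3 ≤ 1# + C
        2/3+2/3≤1+C = begin
          2/3 + 2/3 ≤⟨ +-mono-≤ 2/3≤P₀ 2/3≤P₁ ⟩
          P₀ + P₁   ≤⟨ indistinguishable vertices distinct (𝒜 u) L 0 L refl ℕₚ.≤-refl (near b₀)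
                         (near (z₁ vertices distinct)) late?
                         (λ {y} → disjoint vertices distinct (proj₁ y)) late ⟩
          1# + (C + Pr (run hard b₀ π (𝒜 u)) late?)
            ≡⟨ cong (1# +_) (trans (cong (C +_) late≡0) (+-identityʳ C)) ⟩
          1# + C    ∎

-- Choice of the constants and of the hard instance.

theorem1p8 : (ℛ : Reals) →
    let open Reals ℛ
        open LinearSystems ℛ
    in
    ∃ λ (ε₀ : Carrier) → 0# < ε₀ ×
    ∃ λ (c₁ : Carrier) → 0# < c₁ ×
    ∃ λ (c₂ : Carrier) → 0# < c₂ ×
    ∃ λ (D : ℕ) →
    ∃ λ (c : Carrier) → 0# < c ×
    ∃ λ (n₀ : ℕ) →
    ∀ (n : ℕ) → n₀ ℕ.≤ n →
    (𝒜 : Fin n → Algorithm n) → Solves 𝒜 ε₀ c₁ c₂ D →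
    ∃ λ (S : Matrix n) → ∃ λ (b : Vector n) → Promise c₁ c₂ D S b ×
    ∃ λ (π : NeighborOrdering S) → ∃ λ (u : Fin n) →
    0# < Pr (run S b π (𝒜 u)) (λ (_ , t) → c * Smax S ≤? fromℕ t)
theorem1p8 ℛ =
  fromℕ 8 ⁻¹ , ⁻¹-positive (fromℕ-suc-positive 7) ,
  fromℕ 4 ⁻¹ , ⁻¹-positive (fromℕ-suc-positive 3) ,
  1# , (0≤1 , 0≢1) ,
  1 ,
  fromℕ 2 ⁻¹ , ⁻¹-positive (fromℕ-suc-positive 1) ,
  -- From 16 vertices on, `L` is at least one: the value zero would give `n < 16`.
  16 , bound
  where
  open Reals ℛ
  open LinearSystems ℛ
  open OrderedField ℛ
  bound : ∀ n → 16 ℕ.≤ n → (𝒜 : Fin n → Algorithm n) → Solves 𝒜 (fromℕ 8 ⁻¹) (fromℕ 4 ⁻¹) 1# 1 →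
    ∃ λ (S : Matrix n) → ∃ λ (b : Vector n) → Promise (fromℕ 4 ⁻¹) 1# 1 S b ×
    ∃ λ (π : NeighborOrdering S) → ∃ λ (u : Fin n) →
    0# < Pr (run S b π (𝒜 u)) (λ (_ , t) → fromℕ 2 ⁻¹ * Smax S ≤? fromℕ t)
  bound (suc m) 16≤n 𝒜 solves with ⌊√n/4⌋ (suc m)
  ... | zero  , _ , upper = contradiction 16≤n (ℕₚ.<⇒≱ upper)
  ... | suc ℓ , lower , upper =
    -- The long run already occurs for the zero right-hand side. The other one enters only through
    -- the correctness of the algorithm.
    hard 𝒜 solves , (λ _ → 0#) , promise vertices (distinct 𝒜 solves) _ (λ _ → inj₁ refl) ,
    π 𝒜 solves , u 𝒜 solves , long-run-likely 𝒜 solves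
    where
    open LowerBound ℛ lower upper
    open Greedy ℛ w 0<w (𝒜 zero) (suc ℓ) zero
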